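{- Let $\lambda,\mu,\nu$ be partitions with at most $3$ parts (written as triples $(\xi_1,\xi_2,\xi_3)$, $\xi_1\ge\xi_2\ge\xi_3\ge0$). Then the Littlewood–Richardson coefficient $c^{\lambda}_{\mu,\nu}$ (the coefficient of $s_\lambda$ in $s_\mu s_\nu$, Schur functions) equals $1$ if and only if $(\lambda,\mu,\nu)$ lies on a facet of the Horn cone $\mathcal{H}_3$, i.e. $|\lambda|=|\mu|+|\nu|$, all eighteen inequalities listed below hold, and at least one of them holds with equality.
   Context: The eighteen inequalities defining $\mathcal{H}_3$ (together with $|\lambda|=|\mu|+|\nu|$, where $|\xi|=\xi_1+\xi_2+\xi_3$) are: (1) $\mu_3\le\mu_2$; (2) $\mu_2\le\mu_1$; (3) $\nu_3\le\nu_2$; (4) $\nu_2\le\nu_1$; (5) $\lambda_3\le\lambda_2$; (6) $\lambda_2\le\lambda_1$; (7) $\lambda_1\le\mu_1+\nu_1$; (8) $\lambda_2\le\mu_1+\nu_2$; (9) $\lambda_2\le\mu_2+\nu_1$; (10) $\lambda_3\le\mu_1+\nu_3$; (11) $\lambda_3\le\mu_2+\nu_2$; (12) $\lambda_3\le\mu_3+\nu_1$; (13) $\lambda_3\ge\mu_3+\nu_3$; (14) $\lambda_2\ge\mu_3+\nu_2$; (15) $\lambda_2\ge\mu_2+\nu_3$; (16) $\lambda_1\ge\mu_3+\nu_1$; (17) $\lambda_1\ge\mu_2+\nu_2$; (18) $\lambda_1\ge\mu_1+\nu_3$. A facet is the set of points of $\mathcal{H}_3$ at which one of these inequalities is an equality.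 -}

module Defs where

open import Data.Fin as Fin using (Fin)
open import Data.Fin.Properties as Fin using ()
open import Data.Integer as ℤ using (ℤ; +_)
open import Data.List using (List; []; _∷_; length; map; filter; foldr; concat; zip; allFin; cartesianProductWith)
open import Data.List.Properties as List using ()
open import Data.List.Relation.Unary.All as All using (All)
open import Data.List.Relation.Unary.Any using (Any)
open import Data.List.Relation.Unary.Linked as Linked using (Linked)
open import Data.Nat using (ℕ; zero; suc; _+_; _≤_; _<_; _≥_; _≟_)
open import Data.Product using (_×_; _,_; proj₁; proj₂; ∃-syntax; uncurry)
open import Data.Vec as Vec using (Vec)
open import Data.Vec.Properties as Vec using ()
open import Relation.Binary.PropositionalEquality using (_≡_)
open import Relation.Nullary.Decidable using (Dec; _×-dec_)

-- Zero parts are not stored, so distinct partitions have distinct lists of parts.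
record Partition : Set where
  constructor mkPartition
  field
    parts      : List ℕ
    decreasing : Linked _≥_ parts
    positive   : All (0 <_) parts

open Partition public

ℓ : Partition → ℕ
ℓ κ = length (parts κ)

nth : List ℕ → ℕ → ℕ
nth []       _       = 0
nth (p ∷ _)  zero    = p
nth (_ ∷ ps) (suc i) = nth ps i

-- The parts κ₁, κ₂, κ₃, padded with zeros.
_₁ _₂ _₃ : Partition → ℕ
κ ₁ = nth (parts κ) 0
κ ₂ = nth (parts κ) 1
κ ₃ = nth (parts κ) 2

-- A filling of a Young diagram (English notation), as its list of rows.
-- The entry i : Fin n stands for the variable x_{i+1}.
Filling : ℕ → Set
Filling n = List (List (Fin n))

words : ∀ n → ℕ → List (List (Fin n))
words n zero    = [] ∷ []
words n (suc k) = cartesianProductWith _∷_ (allFin n) (words n k)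

fillings : ∀ n → List ℕ → List (Filling n)
fillings n []       = [] ∷ []
fillings n (p ∷ ps) = cartesianProductWith _∷_ (words n p) (fillings n ps)

-- zip stops at the end of the shorter row, i.e. it pairs vertically adjacent boxes.
_Above_ : ∀ {n} → List (Fin n) → List (Fin n) → Set
r Above r′ = All (uncurry Fin._<_) (zip r r′)

SemiStandard : ∀ {n} → Filling n → Set
SemiStandard T = All (Linked Fin._≤_) T × Linked _Above_ T

semiStandard? : ∀ {n} (T : Filling n) → Dec (SemiStandard T)
semiStandard? T =
  All.all? (Linked.linked? Fin._≤?_) T
    ×-dec Linked.linked? (λ r r′ → All.all? (uncurry Fin._<?_) (zip r r′)) T

ssyt : ∀ n → Partition → List (Filling n)
ssyt n κ = filter semiStandard? (fillings n (parts κ))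

weight : ∀ {n} → Filling n → Vec ℕ n
weight T = Vec.tabulate (λ i → length (filter (i Fin.≟_) (concat T)))

-- Polynomials in n variables with coefficients in ℕ, as formal sums of monomials;
-- a monomial is its exponent vector, and a repeated monomial has that multiplicity
-- as its coefficient.
Poly : ℕ → Set
Poly n = List (Vec ℕ n)

coeff : ∀ {n} → Vec ℕ n → Poly n → ℕ
coeff α p = length (filter (Vec.≡-dec _≟_ α) p)

_⊗_ : ∀ {n} → Poly n → Poly n → Poly n
_⊗_ = cartesianProductWith (Vec.zipWith _+_)

-- s_κ(x₁,…,xₙ) = Σ x^T over semistandard tableaux T of shape κ with entries in {1,…,n}.
schur : ∀ n → Partition → Poly n
schur n κ = map weight (ssyt n κ)

sumℤ : List ℤ → ℤ
sumℤ = foldr ℤ._+_ (+ 0)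

-- Formal finite ℤ-linear combinations Σ a s_κ; terms with equal κ add up.
SchurComb : Set
SchurComb = List (ℤ × Partition)

coeffAt : Partition → SchurComb → ℤ
coeffAt κ L =
  sumℤ (map proj₁ (filter (λ t → List.≡-dec _≟_ (parts κ) (parts (proj₂ t))) L))

-- The coefficient of x^α in Σ a s_κ(x₁,…,xₙ).
evalCoeff : ∀ {n} → Vec ℕ n → SchurComb → ℤ
evalCoeff {n} α L = sumℤ (map (λ t → proj₁ t ℤ.* (+ coeff α (schur n (proj₂ t)))) L)

-- s_μ s_ν = Σ a s_κ as symmetric functions in x₁, x₂, …. A monomial involves only finitely
-- many variables, so this says that all coefficients agree in every number n of variables.
IsSchurExpansion : Partition → Partition → SchurComb → Set
IsSchurExpansion μ ν L =
  ∀ n (α : Vec ℕ n) → + coeff α (schur n μ ⊗ schur n ν) ≡ evalCoeff α L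

-- c is the coefficient of s_lam in s_μ s_ν.
IsLRCoefficient : (lam μ ν : Partition) → ℤ → Set
IsLRCoefficient lam μ ν c = ∃[ L ] (IsSchurExpansion μ ν L × coeffAt lam L ≡ c)

-- The pair (a , b) stands for the inequality a ≤ b.
hornInequalities : (lam μ ν : Partition) → List (ℕ × ℕ)
hornInequalities lam μ ν =
    (μ ₃ , μ ₂)
  ∷ (μ ₂ , μ ₁)
  ∷ (ν ₃ , ν ₂)
  ∷ (ν ₂ , ν ₁)
  ∷ (lam ₃ , lam ₂)
  ∷ (lam ₂ , lam ₁)
  ∷ (lam ₁ , μ ₁ + ν ₁)
  ∷ (lam ₂ , μ ₁ + ν ₂)
  ∷ (lam ₂ , μ ₂ + ν ₁)
  ∷ (lam ₃ , μ ₁ + ν ₃)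
  ∷ (lam ₃ , μ ₂ + ν ₂)
  ∷ (lam ₃ , μ ₃ + ν ₁)
  ∷ (μ ₃ + ν ₃ , lam ₃)
  ∷ (μ ₃ + ν ₂ , lam ₂)
  ∷ (μ ₂ + ν ₃ , lam ₂)
  ∷ (μ ₃ + ν ₁ , lam ₁)
  ∷ (μ ₂ + ν ₂ , lam ₁)
  ∷ (μ ₁ + ν ₃ , lam ₁)
  ∷ []

∣_∣₃ : Partition → ℕ
∣ κ ∣₃ = κ ₁ + κ ₂ + κ ₃

InHornCone : (lam μ ν : Partition) → Set
InHornCone lam μ ν =
  ∣ lam ∣₃ ≡ ∣ μ ∣₃ + ∣ ν ∣₃ × All (uncurry _≤_) (hornInequalities lam μ ν)

OnFacet : (lam μ ν : Partition) → Set
OnFacet lam μ ν = InHornCone lam μ ν × Any (uncurry _≡_) (hornInequalities lam μ ν)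

{-# OPTIONS --safe #-}
module Submission where

-- Let E(p) = Σ sgn(w) [x^w(λ+ρ)] x^ρ p, summed over w ∈ S₃. On a Schur function s_κ this is the sum of
-- F(ρ + content) over the Gelfand–Tsetlin patterns (a, b, i) with top row κ, for an antisymmetric F.
-- In any sum of F(ν + ρ + content), three reflections, each of which exchanges two coordinates of the
-- argument of F, cancel the patterns that violate one of the three Littlewood–Richardson conditions.
-- For ν = 0 a single pattern survives: E(s_κ) = [κ = λ], so that c = E(s_μ s_ν). Since s_μ is
-- symmetric, the same collapse in the factor s_ν gives E(s_μ s_ν) = Σ F(ν + ρ + content) over the
-- patterns with top row μ, and c is the number of Littlewood–Richardson patterns of weight λ - ν. The
-- weight determines i and a + b, while a ranges over an interval with six lower and three upper bounds;
-- the eighteen differences of these bounds are the slacks of the Horn inequalities. Finally, an interval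
-- contains exactly one integer if and only if no lower bound exceeds an upper bound and some lower
-- bound equals an upper bound.

open import Defs
open import Data.Fin as Fin using (Fin)
open import Data.Fin.Patterns using (0F; 1F; 2F; 3F; 4F; 5F)
import Data.Fin.Properties as Finₚ
open import Data.Integer as ℤ using (ℤ; +_; 0ℤ; 1ℤ; _+_; _*_; _-_; -_; ∣_∣)
import Data.Integer.Properties as ℤₚ
open import Data.Integer.Tactic.RingSolver using (solve; solve-∀)
open import Data.List using
  ( List; []; _∷_; _∷ʳ_; _++_; map; filter; length; upTo; replicate; concat; concatMap; deduplicate
  ; allFin; cartesianProduct; cartesianProductWith )
import Data.List.Properties as Listₚ
open import Data.List.Membership.Propositional using (_∈_; lose)
open import Data.List.Membership.Propositional.Properties
open import Data.List.Membership.Propositional.Properties.WithK using (unique∧set⇒bag)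
open import Data.List.Relation.Binary.BagAndSetEquality using (∼bag⇒↭)
open import Data.List.Relation.Binary.Permutation.Propositional using (_↭_; ↭⇒↭ₛ)
import Data.List.Relation.Binary.Permutation.Propositional.Properties as ↭ₚ
open import Data.List.Relation.Binary.Permutation.Setoid.Properties using (foldr-commMonoid)
open import Data.List.Relation.Binary.Pointwise using (Pointwise; []; _∷_; Pointwise-≡⇒≡)
open import Data.List.Relation.Unary.All as All using (All; []; _∷_)
import Data.List.Relation.Unary.All.Properties as Allₚ
open import Data.List.Relation.Unary.AllPairs using ([]; _∷_)
open import Data.List.Relation.Unary.Any as Any using (Any; here; there)
import Data.List.Relation.Unary.Any.Properties as Anyₚ
open import Data.List.Relation.Unary.Linked using (Linked; []; [-]; _∷_)
open import Data.List.Relation.Unary.Unique.DecPropositional.Properties using (deduplicate-!)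
open import Data.List.Relation.Unary.Unique.Propositional using (Unique)
import Data.List.Relation.Unary.Unique.Propositional.Properties as Uniqueₚ
open import Data.Nat as ℕ using (ℕ; zero; suc; z≤n; s≤s)
import Data.Nat.Properties as ℕₚ
open import Data.Product using (_×_; _,_; proj₁; proj₂; ∃₂; ∃!; ∃-syntax; uncurry)
open import Data.Product.Function.NonDependent.Propositional using (_×-⇔_)
import Data.Product.Properties as Productₚ
open import Data.Sum using (inj₁; inj₂)
open import Data.Vec as Vec using (Vec; []; _∷_)
import Data.Vec.Properties as Vecₚ
open import Function using (_∘_)
open import Function.Bundles using (_⇔_; mk⇔; module Equivalence)
open import Function.Construct.Identity using (⇔-id)
open import Function.Related.Propositional using (module EquationalReasoning)
open import Relation.Binary using (DecidableEquality)
open import Relation.Binary.PropositionalEquality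
open import Relation.Nullary using (Dec; yes; no; ¬_; contradiction)
open import Relation.Nullary.Decidable using (¬?; _×-dec_; from-yes)
open import Algebra.Properties.AbelianGroup ℤₚ.+-0-abelianGroup
  using () renaming (∙-cancelˡ to +-cancelˡ)
open import Data.List.Membership.DecPropositional (Productₚ.≡-dec (Fin._≟_ {6}) (Fin._≟_ {3}))
  using (_∈?_)
open Equivalence using (to; from)
open ≡-Reasoning

private variable
  A B C : Set
  P Q : Set

-- Lists and unique existence

∃!-cong : ∀ {A : Set} {P Q : A → Set} → (∀ {x} → P x ⇔ Q x) → ∃! _≡_ P ⇔ ∃! _≡_ Q
∃!-cong P⇔Q = mk⇔
  (λ (x , Px , unique) → x , to P⇔Q Px , λ Qy → unique (from P⇔Q Qy))
  (λ (x , Qx , unique) → x , from P⇔Q Qx , λ Py → unique (to P⇔Q Py))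

module _ {A B C : Set} (f : A → C) (g : B → C) {xs ys} (eq : map f xs ≡ map g ys) (P : C → Set) where

  All-map-≡ : All (P ∘ f) xs ⇔ All (P ∘ g) ys
  All-map-≡ = mk⇔ (Allₚ.map⁻ ∘ subst (All P) eq ∘ Allₚ.map⁺)
                  (Allₚ.map⁻ ∘ subst (All P) (sym eq) ∘ Allₚ.map⁺)

  Any-map-≡ : Any (P ∘ f) xs ⇔ Any (P ∘ g) ys
  Any-map-≡ = mk⇔ (Anyₚ.map⁻ ∘ subst (Any P) eq ∘ Anyₚ.map⁺)
                  (Anyₚ.map⁻ ∘ subst (Any P) (sym eq) ∘ Anyₚ.map⁺)

Unique-map⁺ : ∀ {f : A → B} (g : B → A) {xs} → (∀ {x} → x ∈ xs → g (f x) ≡ x) →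
              Unique xs → Unique (map f xs)
Unique-map⁺ {f = f} g {xs} gf≡id xs! = Uniqueₚ.map⁻ (subst Unique (sym map-gf) xs!)
  where
  map-gf : map g (map f xs) ≡ xs
  map-gf = trans (sym (Listₚ.map-∘ xs)) (Listₚ.map-id-local (All.tabulate gf≡id))

Unique⇒singleton : ∀ {x : A} {xs} → Unique xs → x ∈ xs → (∀ {y} → y ∈ xs → y ≡ x) → xs ≡ x ∷ []
Unique⇒singleton {xs = _ ∷ []}     _              _ y≡x = cong (_∷ []) (y≡x (here refl))
Unique⇒singleton {xs = _ ∷ _ ∷ _} ((y≢z ∷ _) ∷ _) _ y≡x =
  contradiction (trans (y≡x (here refl)) (sym (y≡x (there (here refl))))) y≢z

∃!⇔length≡1 : ∀ {xs : List A} → Unique xs → length xs ≡ 1 ⇔ ∃! _≡_ (_∈ xs)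
∃!⇔length≡1 {A = A} {xs} xs! = mk⇔ (unique xs) λ (_ , x∈xs , x≡) →
  cong length (Unique⇒singleton xs! x∈xs (sym ∘ x≡))
  where
  unique : ∀ (xs : List A) → length xs ≡ 1 → ∃! _≡_ (_∈ xs)
  unique (x ∷ []) _ = x , here refl , λ { (here refl) → refl }

-- Finite sums

∑ : List A → (A → ℤ) → ℤ
∑ xs f = sumℤ (map f xs)

infix 5 ∑
syntax ∑ xs (λ x → e) = ∑[ x ∈ xs ] e

∑-cong : ∀ (xs : List A) {f g : A → ℤ} → (∀ {x} → x ∈ xs → f x ≡ g x) → ∑ xs f ≡ ∑ xs g
∑-cong xs eq = cong sumℤ (Listₚ.map-cong-local (All.tabulate eq))

∑-map : ∀ (g : A → B) xs (f : B → ℤ) → ∑ (map g xs) f ≡ ∑ xs (f ∘ g)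
∑-map g xs f = cong sumℤ (sym (Listₚ.map-∘ xs))

∑-zero : ∀ (xs : List A) → ∑[ _ ∈ xs ] 0ℤ ≡ 0ℤ
∑-zero []       = refl
∑-zero (_ ∷ xs) = trans (ℤₚ.+-identityˡ _) (∑-zero xs)

∑-+ : ∀ (xs : List A) (f g : A → ℤ) → ∑[ x ∈ xs ] (f x + g x) ≡ ∑ xs f + ∑ xs g
∑-+ []       f g = refl
∑-+ (x ∷ xs) f g =
  trans (cong (_+_ (f x + g x)) (∑-+ xs f g)) (interchange (f x) (g x) (∑ xs f) (∑ xs g))
  where
  interchange : ∀ a b c d → a + b + (c + d) ≡ a + c + (b + d)
  interchange = solve-∀

∑-*ˡ : ∀ k (xs : List A) (f : A → ℤ) → ∑[ x ∈ xs ] k * f x ≡ k * ∑ xs f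
∑-*ˡ k []       f = sym (ℤₚ.*-zeroʳ k)
∑-*ˡ k (x ∷ xs) f = trans (cong (_+_ (k * f x)) (∑-*ˡ k xs f)) (sym (ℤₚ.*-distribˡ-+ k (f x) (∑ xs f)))

∑-neg : ∀ (xs : List A) (f : A → ℤ) → ∑[ x ∈ xs ] (- f x) ≡ - ∑ xs f
∑-neg []       f = refl
∑-neg (x ∷ xs) f = trans (cong (_+_ (- f x)) (∑-neg xs f)) (sym (ℤₚ.neg-distrib-+ (f x) (∑ xs f)))

∑-swap : ∀ (xs : List A) (ys : List B) (f : A → B → ℤ) →
         ∑[ x ∈ xs ] ∑[ y ∈ ys ] f x y ≡ ∑[ y ∈ ys ] ∑[ x ∈ xs ] f x y
∑-swap []       ys f = sym (∑-zero ys)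
∑-swap (x ∷ xs) ys f = trans (cong (_+_ (∑ ys (f x))) (∑-swap xs ys f)) (sym (∑-+ ys (f x) _))

∑-++ : ∀ (xs ys : List A) (f : A → ℤ) → ∑ (xs ++ ys) f ≡ ∑ xs f + ∑ ys f
∑-++ []       ys f = sym (ℤₚ.+-identityˡ _)
∑-++ (x ∷ xs) ys f = trans (cong (_+_ (f x)) (∑-++ xs ys f)) (sym (ℤₚ.+-assoc (f x) _ _))

∑-cartesianProductWith : ∀ (_∙_ : A → B → C) xs ys (f : C → ℤ) →
  ∑ (cartesianProductWith _∙_ xs ys) f ≡ ∑[ x ∈ xs ] ∑[ y ∈ ys ] f (x ∙ y)
∑-cartesianProductWith _∙_ []       ys f = refl
∑-cartesianProductWith _∙_ (x ∷ xs) ys f =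
  trans (∑-++ (map (x ∙_) ys) _ f) (cong₂ _+_ (∑-map (x ∙_) ys f) (∑-cartesianProductWith _∙_ xs ys f))

∑-↭ : ∀ {xs ys : List A} (f : A → ℤ) → xs ↭ ys → ∑ xs f ≡ ∑ ys f
∑-↭ f xs↭ys = foldr-commMonoid (setoid ℤ) ℤₚ.+-0-isCommutativeMonoid (↭⇒↭ₛ (↭ₚ.map⁺ f xs↭ys))

∑-reindex : ∀ {xs : List A} {ys : List B} (f : A → B) (g : B → A) → Unique xs → Unique ys →
  (∀ {x} → x ∈ xs → f x ∈ ys × g (f x) ≡ x) → (∀ {y} → y ∈ ys → g y ∈ xs × f (g y) ≡ y) →
  ∀ (h : B → ℤ) → ∑ xs (h ∘ f) ≡ ∑ ys h
∑-reindex {xs = xs} {ys} f g xs! ys! f-into g-into h =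
  trans (sym (∑-map f xs h)) (∑-↭ h (∼bag⇒↭ (unique∧set⇒bag fxs! ys! (mk⇔ fxs⊆ys ys⊆fxs))))
  where
  fxs! : Unique (map f xs)
  fxs! = Unique-map⁺ g (proj₂ ∘ f-into) xs!
  fxs⊆ys : ∀ {y} → y ∈ map f xs → y ∈ ys
  fxs⊆ys y∈fxs with _ , x∈xs , refl ← ∈-map⁻ f y∈fxs = proj₁ (f-into x∈xs)
  ys⊆fxs : ∀ {y} → y ∈ ys → y ∈ map f xs
  ys⊆fxs y∈ys = subst (_∈ map f xs) (proj₂ (g-into y∈ys)) (∈-map⁺ f (proj₁ (g-into y∈ys)))

∑-involution : ∀ {xs : List A} (τ : A → A) → Unique xs → (∀ {x} → x ∈ xs → τ x ∈ xs × τ (τ x) ≡ x) →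
  ∀ (f : A → ℤ) → ∑ xs (f ∘ τ) ≡ ∑ xs f
∑-involution τ xs! τ-into = ∑-reindex τ τ xs! xs! τ-into τ-into

∑-sign-reversing : ∀ {xs : List A} {f : A → ℤ} (τ : A → A) → Unique xs →
  (∀ {x} → x ∈ xs → τ x ∈ xs × τ (τ x) ≡ x) → (∀ {x} → x ∈ xs → f (τ x) ≡ - f x) → ∑ xs f ≡ 0ℤ
∑-sign-reversing {xs = xs} {f} τ xs! τ-into reverses = self-negative (begin
  ∑ xs f               ≡⟨ ∑-involution τ xs! τ-into f ⟨
  ∑ xs (f ∘ τ)         ≡⟨ ∑-cong xs reverses ⟩
  ∑[ x ∈ xs ] (- f x)  ≡⟨ ∑-neg xs f ⟩
  - ∑ xs f             ∎)
  where
  self-negative : ∀ {s} → s ≡ - s → s ≡ 0ℤ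
  self-negative {+ zero} _ = refl

𝟙 : Dec P → ℤ
𝟙 (yes _) = 1ℤ
𝟙 (no  _) = 0ℤ

𝟙-yes : (d : Dec P) → P → 𝟙 d ≡ 1ℤ
𝟙-yes (yes _) p = refl
𝟙-yes (no ¬p) p = contradiction p ¬p

𝟙-no : (d : Dec P) → ¬ P → 𝟙 d ≡ 0ℤ
𝟙-no (yes p) ¬p = contradiction p ¬p
𝟙-no (no _)  ¬p = refl

𝟙-cong : (d : Dec P) (e : Dec Q) → P ⇔ Q → 𝟙 d ≡ 𝟙 e
𝟙-cong (yes p) e P⇔Q = sym (𝟙-yes e (to P⇔Q p))
𝟙-cong (no ¬p) e P⇔Q = sym (𝟙-no e (¬p ∘ from P⇔Q))

module _ {P : A → Set} (P? : ∀ x → Dec (P x)) where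

  ∑-filter : ∀ xs (f : A → ℤ) → ∑ (filter P? xs) f ≡ ∑[ x ∈ xs ] 𝟙 (P? x) * f x
  ∑-filter []       f = refl
  ∑-filter (x ∷ xs) f with P? x
  ... | yes _ = cong₂ _+_ (sym (ℤₚ.*-identityˡ (f x))) (∑-filter xs f)
  ... | no  _ = trans (∑-filter xs f) (sym (ℤₚ.+-identityˡ _))

  length-filter≡∑ : ∀ xs → + length (filter P? xs) ≡ ∑[ x ∈ xs ] 𝟙 (P? x)
  length-filter≡∑ []       = refl
  length-filter≡∑ (x ∷ xs) with P? x
  ... | yes _ = cong (_+_ 1ℤ) (length-filter≡∑ xs)
  ... | no  _ = trans (length-filter≡∑ xs) (sym (ℤₚ.+-identityˡ _))

  ∑-partition : ∀ xs (f : A → ℤ) → ∑ xs f ≡ ∑ (filter P? xs) f + ∑ (filter (¬? ∘ P?) xs) f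
  ∑-partition []       f = refl
  ∑-partition (x ∷ xs) f with P? x
  ... | yes _ = trans (cong (_+_ (f x)) (∑-partition xs f)) (sym (ℤₚ.+-assoc (f x) _ _))
  ... | no  _ = trans (cong (_+_ (f x)) (∑-partition xs f)) (exchange (f x) (∑ (filter P? xs) f) _)
    where
    exchange : ∀ a b c → a + (b + c) ≡ b + (a + c)
    exchange = solve-∀

  ∑-cancel : ∀ {xs} {f : A → ℤ} (τ : A → A) → Unique xs →
    (∀ {x} → x ∈ xs → ¬ P x → (τ x ∈ xs × ¬ P (τ x)) × τ (τ x) ≡ x × f (τ x) ≡ - f x) →
    ∑ xs f ≡ ∑ (filter P? xs) f
  ∑-cancel {xs} {f} τ xs! reverses = begin
    ∑ xs f                                              ≡⟨ ∑-partition xs f ⟩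
    ∑ (filter P? xs) f + ∑ (filter (¬? ∘ P?) xs) f      ≡⟨ cong (_+_ (∑ (filter P? xs) f)) rejected ⟩
    ∑ (filter P? xs) f + 0ℤ                             ≡⟨ ℤₚ.+-identityʳ _ ⟩
    ∑ (filter P? xs) f                                  ∎
    where
    reverses′ : ∀ {x} → x ∈ filter (¬? ∘ P?) xs → (τ x ∈ xs × ¬ P (τ x)) × τ (τ x) ≡ x × f (τ x) ≡ - f x
    reverses′ x∈ = let x∈xs , ¬Px = ∈-filter⁻ (¬? ∘ P?) x∈ in reverses x∈xs ¬Px
    rejected : ∑ (filter (¬? ∘ P?) xs) f ≡ 0ℤ
    rejected = ∑-sign-reversing τ (Uniqueₚ.filter⁺ (¬? ∘ P?) xs!)
      (λ x∈ → let (τx∈xs , ¬Pτx) , ττx≡x , _ = reverses′ x∈ in ∈-filter⁺ (¬? ∘ P?) τx∈xs ¬Pτx , ττx≡x)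
      (λ x∈ → proj₂ (proj₂ (reverses′ x∈)))

∑-δ : ∀ (_≟_ : DecidableEquality A) {xs y} → Unique xs → y ∈ xs → ∀ (f : A → ℤ) →
      ∑[ x ∈ xs ] 𝟙 (x ≟ y) * f x ≡ f y
∑-δ _≟_ {xs} {y} xs! y∈xs f = begin
  ∑[ x ∈ xs ] 𝟙 (x ≟ y) * f x  ≡⟨ ∑-filter (_≟ y) xs f ⟨
  ∑ (filter (_≟ y) xs) f       ≡⟨ cong (λ zs → ∑ zs f) (Unique⇒singleton (Uniqueₚ.filter⁺ (_≟ y) xs!)
                                    (∈-filter⁺ (_≟ y) y∈xs refl) (proj₂ ∘ ∈-filter⁻ (_≟ y) {xs = xs})) ⟩
  f y + 0ℤ                     ≡⟨ ℤₚ.+-identityʳ (f y) ⟩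
  f y                          ∎

-- Polynomials as formal sums

private
  _≟ᵛ_ : ∀ {n} → DecidableEquality (Vec ℕ n)
  _≟ᵛ_ = Vecₚ.≡-dec ℕ._≟_

∑-by-coeff : ∀ {n} {αs : List (Vec ℕ n)} p → Unique αs → (∀ {β} → β ∈ p → β ∈ αs) → ∀ f →
  ∑ p f ≡ ∑[ α ∈ αs ] + coeff α p * f α
∑-by-coeff {αs = αs} p αs! p⊆αs f = begin
  ∑ p f                                     ≡⟨ ∑-cong p (λ β∈p → sym (∑-δ _≟ᵛ_ αs! (p⊆αs β∈p) f)) ⟩
  ∑[ β ∈ p ] ∑[ α ∈ αs ] 𝟙 (α ≟ᵛ β) * f α   ≡⟨ ∑-swap p αs _ ⟩
  ∑[ α ∈ αs ] ∑[ β ∈ p ] 𝟙 (α ≟ᵛ β) * f α   ≡⟨ ∑-cong αs (λ {α} _ → coefficient α) ⟩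
  ∑[ α ∈ αs ] + coeff α p * f α             ∎
  where
  coefficient : ∀ α → ∑[ β ∈ p ] 𝟙 (α ≟ᵛ β) * f α ≡ + coeff α p * f α
  coefficient α = begin
    ∑[ β ∈ p ] 𝟙 (α ≟ᵛ β) * f α    ≡⟨ ∑-cong p (λ {β} _ → ℤₚ.*-comm (𝟙 (α ≟ᵛ β)) (f α)) ⟩
    ∑[ β ∈ p ] f α * 𝟙 (α ≟ᵛ β)    ≡⟨ ∑-*ˡ (f α) p _ ⟩
    f α * (∑[ β ∈ p ] 𝟙 (α ≟ᵛ β))  ≡⟨ cong (f α *_) (length-filter≡∑ (α ≟ᵛ_) p) ⟨
    f α * + coeff α p              ≡⟨ ℤₚ.*-comm (f α) _ ⟩
    + coeff α p * f α              ∎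

∑-schurExpansion : ∀ {n} p L → (∀ (α : Vec ℕ n) → + coeff α p ≡ evalCoeff α L) → ∀ f →
  ∑ p f ≡ ∑[ t ∈ L ] proj₁ t * ∑ (schur n (proj₂ t)) f
∑-schurExpansion {n} p L expansion f = begin
  ∑ p f
    ≡⟨ ∑-by-coeff p αs! (∈-deduplicate⁺ _≟ᵛ_ ∘ ∈-++⁺ˡ) f ⟩
  ∑[ α ∈ αs ] + coeff α p * f α
    ≡⟨ ∑-cong αs (λ {α} _ → regroup α) ⟩
  ∑[ α ∈ αs ] ∑[ t ∈ L ] proj₁ t * (+ coeff α (schur n (proj₂ t)) * f α)
    ≡⟨ ∑-swap αs L _ ⟩
  ∑[ t ∈ L ] ∑[ α ∈ αs ] proj₁ t * (+ coeff α (schur n (proj₂ t)) * f α)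
    ≡⟨ ∑-cong L (λ {t} t∈L → trans (∑-*ˡ (proj₁ t) αs _) (cong (proj₁ t *_)
         (sym (∑-by-coeff (schur n (proj₂ t)) αs! (schur⊆αs t∈L) f)))) ⟩
  ∑[ t ∈ L ] proj₁ t * ∑ (schur n (proj₂ t)) f ∎
  where
  αs : List (Vec ℕ n)
  αs = deduplicate _≟ᵛ_ (p ++ concatMap (schur n ∘ proj₂) L)
  αs! : Unique αs
  αs! = deduplicate-! _≟ᵛ_ (p ++ concatMap (schur n ∘ proj₂) L)
  schur⊆αs : ∀ {t} → t ∈ L → ∀ {β} → β ∈ schur n (proj₂ t) → β ∈ αs
  schur⊆αs t∈L β∈ = ∈-deduplicate⁺ _≟ᵛ_
    (∈-++⁺ʳ p (∈-concatMap⁺ (schur n ∘ proj₂) (Any.map (λ { refl → β∈ }) t∈L)))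
  regroup : ∀ α → + coeff α p * f α ≡ ∑[ t ∈ L ] proj₁ t * (+ coeff α (schur n (proj₂ t)) * f α)
  regroup α = begin
    + coeff α p * f α       ≡⟨ cong (_* f α) (expansion α) ⟩
    evalCoeff α L * f α     ≡⟨ ℤₚ.*-comm (evalCoeff α L) (f α) ⟩
    f α * evalCoeff α L     ≡⟨ ∑-*ˡ (f α) L _ ⟨
    ∑[ t ∈ L ] f α * (proj₁ t * + coeff α (schur n (proj₂ t)))
                            ≡⟨ ∑-cong L (λ {t} _ → rotate (f α) (proj₁ t) _) ⟩
    ∑[ t ∈ L ] proj₁ t * (+ coeff α (schur n (proj₂ t)) * f α) ∎
    where
    rotate : ∀ a b c → a * (b * c) ≡ b * (c * a)
    rotate = solve-∀

-- Integer intervals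

module Intervals where
  open import Data.Integer using (_≤_; _<_; _⊔_; _⊓_; _≤?_)

  ≤-fromDifference : ∀ {i j k l} → i ≤ j → j - i ≡ l - k → k ≤ l
  ≤-fromDifference i≤j eq = ℤₚ.0≤i-j⇒j≤i (subst (0ℤ ≤_) eq (ℤₚ.i≤j⇒0≤j-i i≤j))

  <⇒1+≤ : ∀ {i j} → i < j → 1ℤ + i ≤ j
  <⇒1+≤ = ℤₚ.i<j⇒suc[i]≤j

  ≤⇔≤ : ∀ {i j k l} → j - i ≡ l - k → i ≤ j ⇔ k ≤ l
  ≤⇔≤ eq = mk⇔ (λ i≤j → ≤-fromDifference i≤j eq) (λ k≤l → ≤-fromDifference k≤l (sym eq))

  <⇔≤ : ∀ {i j k l} → j - (1ℤ + i) ≡ l - k → i < j ⇔ k ≤ l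
  <⇔≤ eq = mk⇔ (λ i<j → ≤-fromDifference (<⇒1+≤ i<j) eq)
               (λ k≤l → ℤₚ.suc[i]≤j⇒i<j (≤-fromDifference k≤l (sym eq)))

  ≮⇔≤ : ∀ {i j k l} → i - j ≡ l - k → (¬ i < j) ⇔ k ≤ l
  ≮⇔≤ eq = mk⇔ (λ i≮j → ≤-fromDifference (ℤₚ.≮⇒≥ i≮j) eq)
               (λ k≤l → ℤₚ.≤⇒≯ (≤-fromDifference k≤l (sym eq)))

  i-j≤i : ∀ {i j} → 0ℤ ≤ j → i - j ≤ i
  i-j≤i {i} {j} 0≤j = ≤-fromDifference 0≤j (gap i j)
    where
    gap : ∀ i j → j - 0ℤ ≡ i - (i - j)
    gap = solve-∀

  ⊔+⊓≡+ : ∀ i j → i ⊔ j + i ⊓ j ≡ i + j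
  ⊔+⊓≡+ i j with ℤₚ.≤-total i j
  ... | inj₁ i≤j = trans (cong₂ _+_ (ℤₚ.i≤j⇒i⊔j≡j i≤j) (ℤₚ.i≤j⇒i⊓j≡i i≤j)) (ℤₚ.+-comm j i)
  ... | inj₂ j≤i = cong₂ _+_ (ℤₚ.i≥j⇒i⊔j≡i j≤i) (ℤₚ.i≥j⇒i⊓j≡j j≤i)

  infix 4 _∈[_,_] _∈[_,_]?

  _∈[_,_] : ℤ → ℤ → ℤ → Set
  x ∈[ lo , hi ] = lo ≤ x × x ≤ hi

  _∈[_,_]? : ∀ x lo hi → Dec (x ∈[ lo , hi ])
  x ∈[ lo , hi ]? = lo ≤? x ×-dec x ≤? hi

  interval : ℤ → ℤ → List ℤ
  interval lo hi = map (λ k → lo + + k) (upTo (suc ∣ hi - lo ∣))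

  interval-unique : ∀ lo hi → Unique (interval lo hi)
  interval-unique lo hi = Uniqueₚ.map⁺ (ℤₚ.+-injective ∘ +-cancelˡ lo _ _) (Uniqueₚ.upTo⁺ _)

  ∈-interval⁺ : ∀ {x lo hi} → x ∈[ lo , hi ] → x ∈ interval lo hi
  ∈-interval⁺ {x} {lo} {hi} (lo≤x , x≤hi) =
    subst (_∈ interval lo hi) offset (∈-map⁺ _ (∈-upTo⁺ (s≤s (ℤₚ.drop‿+≤+ bound))))
    where
    0≤x-lo : 0ℤ ≤ x - lo
    0≤x-lo = ℤₚ.i≤j⇒0≤j-i lo≤x
    0≤hi-lo : 0ℤ ≤ hi - lo
    0≤hi-lo = ℤₚ.i≤j⇒0≤j-i (ℤₚ.≤-trans lo≤x x≤hi)
    bound : + ∣ x - lo ∣ ≤ + ∣ hi - lo ∣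
    bound = subst₂ _≤_ (sym (ℤₚ.0≤i⇒+∣i∣≡i 0≤x-lo)) (sym (ℤₚ.0≤i⇒+∣i∣≡i 0≤hi-lo))
      (ℤₚ.+-monoˡ-≤ (- lo) x≤hi)
    offset : lo + + ∣ x - lo ∣ ≡ x
    offset = trans (cong (_+_ lo) (ℤₚ.0≤i⇒+∣i∣≡i 0≤x-lo)) (regroup lo x)
      where
      regroup : ∀ lo x → lo + (x - lo) ≡ x
      regroup = solve-∀

  reflect : ℤ → ℤ → ℤ → ℤ
  reflect lo hi x = lo + hi - x

  reflect-∈ : ∀ {lo hi x} → x ∈[ lo , hi ] → reflect lo hi x ∈[ lo , hi ]
  reflect-∈ {lo} {hi} {x} (lo≤x , x≤hi) =
    ≤-fromDifference x≤hi (lower lo hi x) , ≤-fromDifference lo≤x (upper lo hi x)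
    where
    lower : ∀ lo hi x → hi - x ≡ lo + hi - x - lo
    lower = solve-∀
    upper : ∀ lo hi x → x - lo ≡ hi - (lo + hi - x)
    upper = solve-∀

  reflect-involutive : ∀ lo hi x → reflect lo hi (reflect lo hi x) ≡ x
  reflect-involutive = involutive
    where
    involutive : ∀ lo hi x → lo + hi - (lo + hi - x) ≡ x
    involutive = solve-∀

open Intervals

-- Integers between finitely many bounds

module Bounds {m n : ℕ} (lower : Fin m → ℤ) (upper : Fin n → ℤ) where
  open import Data.Integer using (_≤_; _≤?_)

  Between : ℤ → Set
  Between a = (∀ i → lower i ≤ a) × (∀ j → a ≤ upper j)

  Consistent Tight : Set
  Consistent = ∀ i j → lower i ≤ upper j
  Tight      = ∃₂ λ i j → lower i ≡ upper j

  ∃!-between : ∃! _≡_ Between ⇔ (Consistent × Tight)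
  ∃!-between = mk⇔
    (λ (a , (lower≤a , a≤upper) , unique) →
         (λ i j → ℤₚ.≤-trans (lower≤a i) (a≤upper j))
       , tight lower≤a a≤upper unique)
    (λ { (consistent , i , j , eq) →
         lower i
       , ((λ i′ → subst (lower i′ ≤_) (sym eq) (consistent i′ j)) , consistent i)
       , λ (lower≤b , b≤upper) → ℤₚ.≤-antisym (lower≤b i) (subst (_ ≤_) (sym eq) (b≤upper j)) })
    where
    tight : ∀ {a} → (∀ i → lower i ≤ a) → (∀ j → a ≤ upper j) → (∀ {b} → Between b → a ≡ b) → Tight
    tight {a} lower≤a a≤upper unique =
      let i , lower≰a-1 = Finₚ.¬∀⟶∃¬ m _ (λ i → lower i ≤? ℤ.pred a) λ lower≤a-1 →
            a≢a-1 (unique (lower≤a-1 , λ j → ℤₚ.i≤j⇒pred[i]≤j (a≤upper j)))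
          j , a+1≰upper = Finₚ.¬∀⟶∃¬ n _ (λ j → ℤ.suc a ≤? upper j) λ a+1≤upper →
            ℤₚ.i≢suc[i] (unique ((λ i → ℤₚ.≤-trans (lower≤a i) (ℤₚ.i≤suc[i] a)) , a+1≤upper))
          a≤lower = ℤₚ.≮⇒≥ (lower≰a-1 ∘ ℤₚ.i<j⇒i≤pred[j])
          upper≤a = ℤₚ.≮⇒≥ (a+1≰upper ∘ ℤₚ.i<j⇒suc[i]≤j)
      in i , j , trans (ℤₚ.≤-antisym (lower≤a i) a≤lower) (ℤₚ.≤-antisym (a≤upper j) upper≤a)
      where
      a≢a-1 : a ≢ ℤ.pred a
      a≢a-1 eq = ℤₚ.i≢suc[i] (trans (sym eq) (sym (ℤₚ.suc-pred a)))

-- Antisymmetric functions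

ℤ³ : Set
ℤ³ = ℤ × ℤ × ℤ

infixl 6 _⊕_

_⊕_ : ℤ³ → ℤ³ → ℤ³
(x₁ , x₂ , x₃) ⊕ (y₁ , y₂ , y₃) = x₁ + y₁ , x₂ + y₂ , x₃ + y₃

swap₁₂ swap₂₃ : ℤ³ → ℤ³
swap₁₂ (x₁ , x₂ , x₃) = x₂ , x₁ , x₃
swap₂₃ (x₁ , x₂ , x₃) = x₁ , x₃ , x₂

triple-≡ : ∀ {x₁ x₂ x₃ y₁ y₂ y₃ : ℤ} → x₁ ≡ y₁ → x₂ ≡ y₂ → x₃ ≡ y₃ → (x₁ , x₂ , x₃) ≡ (y₁ , y₂ , y₃)
triple-≡ refl refl refl = refl

⊕-identityˡ : ∀ p → (0ℤ , 0ℤ , 0ℤ) ⊕ p ≡ p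
⊕-identityˡ (x₁ , x₂ , x₃) = triple-≡ (ℤₚ.+-identityˡ x₁) (ℤₚ.+-identityˡ x₂) (ℤₚ.+-identityˡ x₃)

⊕-comm : ∀ p q → p ⊕ q ≡ q ⊕ p
⊕-comm (x₁ , x₂ , x₃) (y₁ , y₂ , y₃) = triple-≡ (ℤₚ.+-comm x₁ y₁) (ℤₚ.+-comm x₂ y₂) (ℤₚ.+-comm x₃ y₃)

⊕-assoc : ∀ p q r → (p ⊕ q) ⊕ r ≡ p ⊕ (q ⊕ r)
⊕-assoc (x₁ , x₂ , x₃) (y₁ , y₂ , y₃) (z₁ , z₂ , z₃) =
  triple-≡ (ℤₚ.+-assoc x₁ y₁ z₁) (ℤₚ.+-assoc x₂ y₂ z₂) (ℤₚ.+-assoc x₃ y₃ z₃)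

_≟³_ : DecidableEquality ℤ³
_≟³_ = Productₚ.≡-dec ℤ._≟_ (Productₚ.≡-dec ℤ._≟_ ℤ._≟_)

⊕-cancelˡ : ∀ p {q r} → p ⊕ q ≡ p ⊕ r → q ≡ r
⊕-cancelˡ (x₁ , x₂ , x₃) eq = triple-≡
  (+-cancelˡ x₁ _ _ (cong proj₁ eq))
  (+-cancelˡ x₂ _ _ (cong (proj₁ ∘ proj₂) eq))
  (+-cancelˡ x₃ _ _ (cong (proj₂ ∘ proj₂) eq))

ρ : ℤ³
ρ = + 2 , + 1 , + 0

Antisymmetric : (ℤ³ → ℤ) → Set
Antisymmetric F = (∀ p → F (swap₁₂ p) ≡ - F p) × (∀ p → F (swap₂₃ p) ≡ - F p)

antisymmetrize : (ℤ³ → ℤ) → ℤ³ → ℤ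
antisymmetrize F (x , y , z) =
  F (x , y , z) - F (y , x , z) - F (x , z , y) - F (z , y , x) + F (y , z , x) + F (z , x , y)

antisymmetrize-antisymmetric : ∀ F → Antisymmetric (antisymmetrize F)
antisymmetrize-antisymmetric F =
    (λ (x , y , z) → transposed₁₂
      (F (x , y , z)) (F (y , x , z)) (F (x , z , y)) (F (z , y , x)) (F (y , z , x)) (F (z , x , y)))
  , (λ (x , y , z) → transposed₂₃
      (F (x , y , z)) (F (y , x , z)) (F (x , z , y)) (F (z , y , x)) (F (y , z , x)) (F (z , x , y)))
  where
  transposed₁₂ : ∀ xyz yxz xzy zyx yzx zxy →
    yxz - xyz - yzx - zxy + xzy + zyx ≡ - (xyz - yxz - xzy - zyx + yzx + zxy)
  transposed₁₂ = solve-∀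
  transposed₂₃ : ∀ xyz yxz xzy zyx yzx zxy →
    xzy - zxy - xyz - yzx + zyx + yxz ≡ - (xyz - yxz - xzy - zyx + yzx + zxy)
  transposed₂₃ = solve-∀

module _ where
  open import Data.Integer using (_<_)

  StrictlyDecreasing : ℤ³ → Set
  StrictlyDecreasing (x , y , z) = y < x × z < y

  antisymmetrize-chamber : ∀ F → (∀ p → ¬ StrictlyDecreasing p → F p ≡ 0ℤ) →
    ∀ {p} → StrictlyDecreasing p → antisymmetrize F p ≡ F p
  antisymmetrize-chamber F F≡0 {x , y , z} (y<x , z<y)
    rewrite F≡0 (y , x , z) (λ (x<y , _) → ℤₚ.<-asym x<y y<x)
          | F≡0 (x , z , y) (λ (_ , y<z) → ℤₚ.<-asym y<z z<y)
          | F≡0 (z , y , x) (λ (y<z , _) → ℤₚ.<-asym y<z z<y)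
          | F≡0 (y , z , x) (λ (_ , x<z) → ℤₚ.<-asym x<z (ℤₚ.<-trans z<y y<x))
          | F≡0 (z , x , y) (λ (x<z , _) → ℤₚ.<-asym x<z (ℤₚ.<-trans z<y y<x)) =
    unit (F (x , y , z))
    where
    unit : ∀ s → s - 0ℤ - 0ℤ - 0ℤ + 0ℤ + 0ℤ ≡ s
    unit = solve-∀

-- Gelfand–Tsetlin patterns

-- (a , b , i) stands for the pattern with rows (m₁ , m₂ , m₃), (a , b) and (i).
module GelfandTsetlin (m₁ m₂ m₃ : ℤ) where
  open import Data.Integer using (_≤_; _<_; _⊔_; _⊓_; _≤?_; _<?_)

  Interlacing : ℤ³ → Set
  Interlacing (a , b , i) = a ∈[ m₂ , m₁ ] × b ∈[ m₃ , m₂ ] × i ∈[ b , a ]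

  interlacing? : ∀ t → Dec (Interlacing t)
  interlacing? (a , b , i) = a ∈[ m₂ , m₁ ]? ×-dec b ∈[ m₃ , m₂ ]? ×-dec i ∈[ b , a ]?

  private
    entries : List ℤ
    entries = interval m₃ m₁

    candidates : List ℤ³
    candidates = cartesianProduct entries (cartesianProduct entries entries)

  patterns : List ℤ³
  patterns = filter interlacing? candidates

  patterns-unique : Unique patterns
  patterns-unique = Uniqueₚ.filter⁺ interlacing?
    (Uniqueₚ.cartesianProduct⁺ entries! (Uniqueₚ.cartesianProduct⁺ entries! entries!))
    where
    entries! : Unique entries
    entries! = interval-unique m₃ m₁

  ∈-patterns : ∀ {t} → t ∈ patterns ⇔ Interlacing t
  ∈-patterns = mk⇔ (proj₂ ∘ ∈-filter⁻ interlacing? {xs = candidates}) complete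
    where
    complete : ∀ {t} → Interlacing t → t ∈ patterns
    complete t-interlacing@((m₂≤a , a≤m₁) , (m₃≤b , b≤m₂) , (b≤i , i≤a)) =
      ∈-filter⁺ interlacing?
        (∈-cartesianProduct⁺ (entry (m₃≤b ⟨≤⟩ b≤m₂ ⟨≤⟩ m₂≤a) a≤m₁)
          (∈-cartesianProduct⁺ (entry m₃≤b (b≤m₂ ⟨≤⟩ m₂≤a ⟨≤⟩ a≤m₁))
            (entry (m₃≤b ⟨≤⟩ b≤i) (i≤a ⟨≤⟩ a≤m₁))))
        t-interlacing
      where
      infixl 5 _⟨≤⟩_
      _⟨≤⟩_ : ∀ {x y z} → x ≤ y → y ≤ z → x ≤ z
      _⟨≤⟩_ = ℤₚ.≤-trans
      entry : ∀ {x} → m₃ ≤ x → x ≤ m₁ → x ∈ entries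
      entry m₃≤x x≤m₁ = ∈-interval⁺ (m₃≤x , x≤m₁)

  -- The content of the corresponding tableau: the differences of successive row sums.
  content : ℤ³ → ℤ³
  content (a , b , i) = i , a + b - i , m₁ + m₂ + m₃ - (a + b)

  private
    b-bound : (c a i : ℤ) → ℤ
    b-bound c a i = m₁ + m₂ + i - c - (a + a)

  -- The Bender–Knuth involutions are the cases c = 0 of flip-i and flip-ab.
  flip-i flip-ab flip-b : ℤ → ℤ³ → ℤ³
  flip-i  c (a , b , i) = a , b , reflect b (a - c) i
  flip-ab c (a , b , i) = reflect (m₂ ⊔ i) (m₁ - c) a , reflect m₃ (m₂ ⊓ i) b , i
  flip-b  c (a , b , i) = a , reflect m₃ (b-bound c a i) b , i

  flip-i-involutive : ∀ c t → flip-i c (flip-i c t) ≡ t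
  flip-i-involutive c (a , b , i) = triple-≡ refl refl (reflect-involutive b (a - c) i)

  flip-ab-involutive : ∀ c t → flip-ab c (flip-ab c t) ≡ t
  flip-ab-involutive c (a , b , i) =
    triple-≡ (reflect-involutive (m₂ ⊔ i) (m₁ - c) a) (reflect-involutive m₃ (m₂ ⊓ i) b) refl

  flip-b-involutive : ∀ c t → flip-b c (flip-b c t) ≡ t
  flip-b-involutive c (a , b , i) =
    triple-≡ refl (reflect-involutive m₃ (b-bound c a i) b) refl

  module _ (k₁ k₂ k₃ : ℤ) where
    private
      k : ℤ³
      k = k₁ , k₂ , k₃

    content-flip-i : ∀ t → k ⊕ content (flip-i (k₁ - k₂) t) ≡ swap₁₂ (k ⊕ content t)
    content-flip-i (a , b , i) = triple-≡ (first k₁ k₂ a b i) (second k₁ k₂ a b i) refl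
      where
      first : ∀ k₁ k₂ a b i → k₁ + (b + (a - (k₁ - k₂)) - i) ≡ k₂ + (a + b - i)
      first = solve-∀
      second : ∀ k₁ k₂ a b i → k₂ + (a + b - (b + (a - (k₁ - k₂)) - i)) ≡ k₁ + i
      second = solve-∀

    reflected-row-sum : ∀ i s {s′} → s′ ≡ m₁ + m₂ + m₃ + i - (k₂ - k₃) - s →
      k ⊕ (i , s′ - i , m₁ + m₂ + m₃ - s′) ≡ swap₂₃ (k ⊕ (i , s - i , m₁ + m₂ + m₃ - s))
    reflected-row-sum i s s′≡ = trans (cong (λ s′ → k ⊕ (i , s′ - i , m₁ + m₂ + m₃ - s′)) s′≡)
      (triple-≡ refl (second (m₁ + m₂ + m₃) k₂ k₃ s i) (third (m₁ + m₂ + m₃) k₂ k₃ s i))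
      where
      second : ∀ m k₂ k₃ s i → k₂ + (m + i - (k₂ - k₃) - s - i) ≡ k₃ + (m - s)
      second = solve-∀
      third : ∀ m k₂ k₃ s i → k₃ + (m - (m + i - (k₂ - k₃) - s)) ≡ k₂ + (s - i)
      third = solve-∀

    content-flip-ab : ∀ t → k ⊕ content (flip-ab (k₂ - k₃) t) ≡ swap₂₃ (k ⊕ content t)
    content-flip-ab (a , b , i) = reflected-row-sum i (a + b) (begin
      reflect (m₂ ⊔ i) (m₁ - (k₂ - k₃)) a + reflect m₃ (m₂ ⊓ i) b
        ≡⟨ regroup a b m₁ m₃ (k₂ - k₃) (m₂ ⊔ i) (m₂ ⊓ i) ⟩
      m₂ ⊔ i + m₂ ⊓ i + (m₁ + m₃ - (k₂ - k₃) - (a + b))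
        ≡⟨ cong (_+ (m₁ + m₃ - (k₂ - k₃) - (a + b))) (⊔+⊓≡+ m₂ i) ⟩
      m₂ + i + (m₁ + m₃ - (k₂ - k₃) - (a + b))
        ≡⟨ regroup′ a b i m₁ m₂ m₃ (k₂ - k₃) ⟩
      m₁ + m₂ + m₃ + i - (k₂ - k₃) - (a + b) ∎)
      where
      regroup : ∀ a b m₁ m₃ c α β → α + (m₁ - c) - a + (m₃ + β - b) ≡ α + β + (m₁ + m₃ - c - (a + b))
      regroup = solve-∀
      regroup′ : ∀ a b i m₁ m₂ m₃ c → m₂ + i + (m₁ + m₃ - c - (a + b)) ≡ m₁ + m₂ + m₃ + i - c - (a + b)
      regroup′ = solve-∀

    content-flip-b : ∀ t → k ⊕ content (flip-b (k₂ - k₃) t) ≡ swap₂₃ (k ⊕ content t)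
    content-flip-b (a , b , i) = reflected-row-sum i (a + b) (regroup a b i m₁ m₂ m₃ (k₂ - k₃))
      where
      regroup : ∀ a b i m₁ m₂ m₃ c →
        a + (m₃ + (m₁ + m₂ + i - c - (a + a)) - b) ≡ m₁ + m₂ + m₃ + i - c - (a + b)
      regroup = solve-∀

  flip-i-interlacing : ∀ {c a b i} → 0ℤ ≤ c → Interlacing (a , b , i) → i ≤ a - c →
    Interlacing (flip-i c (a , b , i)) × reflect b (a - c) i ≤ a - c
  flip-i-interlacing {c} {a} 0≤c (a∈ , b∈ , (b≤i , _)) i≤a-c =
    let b≤i′ , i′≤a-c = reflect-∈ (b≤i , i≤a-c)
    in (a∈ , b∈ , (b≤i′ , ℤₚ.≤-trans i′≤a-c (i-j≤i 0≤c))) , i′≤a-c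

  flip-ab-interlacing : ∀ {c a b i} → 0ℤ ≤ c → Interlacing (a , b , i) → a ≤ m₁ - c →
    Interlacing (flip-ab c (a , b , i)) × reflect (m₂ ⊔ i) (m₁ - c) a ≤ m₁ - c
  flip-ab-interlacing {c} {a} {b} {i} 0≤c ((m₂≤a , _) , (m₃≤b , b≤m₂) , (b≤i , i≤a)) a≤m₁-c =
    let α≤a′ , a′≤m₁-c = reflect-∈ {m₂ ⊔ i} (ℤₚ.⊔-lub m₂≤a i≤a , a≤m₁-c)
        m₃≤b′ , b′≤β = reflect-∈ {hi = m₂ ⊓ i} (m₃≤b , ℤₚ.⊓-glb b≤m₂ b≤i)
    in ( (ℤₚ.≤-trans (ℤₚ.i≤i⊔j m₂ i) α≤a′ , ℤₚ.≤-trans a′≤m₁-c (i-j≤i 0≤c))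
       , (m₃≤b′ , ℤₚ.≤-trans b′≤β (ℤₚ.i⊓j≤i m₂ i))
       , (ℤₚ.≤-trans b′≤β (ℤₚ.i⊓j≤j m₂ i) , ℤₚ.≤-trans (ℤₚ.i≤j⊔i m₂ i) α≤a′))
     , a′≤m₁-c

  flip-b-interlacing : ∀ {c a b i} → Interlacing (a , b , i) → m₁ - c ≤ a → b ≤ b-bound c a i →
    let b′ = reflect m₃ (b-bound c a i) b
    in Interlacing (a , b′ , i) × b′ ≤ b-bound c a i
  flip-b-interlacing {c} {a} {b} {i} (a∈@(m₂≤a , _) , (m₃≤b , _) , (_ , i≤a)) m₁-c≤a b≤bound =
    let m₃≤b′ , b′≤bound = reflect-∈ (m₃≤b , b≤bound)
    in (a∈ , (m₃≤b′ , ℤₚ.≤-trans b′≤bound bound≤m₂) , (ℤₚ.≤-trans b′≤bound bound≤i , i≤a)) , b′≤bound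
    where
    bound≤m₂ : b-bound c a i ≤ m₂
    bound≤m₂ = ≤-fromDifference (ℤₚ.+-mono-≤ m₁-c≤a i≤a) (gap m₁ m₂ c a i)
      where
      gap : ∀ m₁ m₂ c a i → a + a - (m₁ - c + i) ≡ m₂ - (m₁ + m₂ + i - c - (a + a))
      gap = solve-∀
    bound≤i : b-bound c a i ≤ i
    bound≤i = ≤-fromDifference (ℤₚ.+-mono-≤ m₁-c≤a m₂≤a) (gap m₁ m₂ c a i)
      where
      gap : ∀ m₁ m₂ c a i → a + a - (m₁ - c + m₂) ≡ i - (m₁ + m₂ + i - c - (a + a))
      gap = solve-∀

  private
    ∑-patterns-flip : ∀ (flip swap : ℤ³ → ℤ³) → (∀ t → flip (flip t) ≡ t) →
      (∀ {t} → Interlacing t → Interlacing (flip t)) →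
      (∀ t → (0ℤ , 0ℤ , 0ℤ) ⊕ content (flip t) ≡ swap ((0ℤ , 0ℤ , 0ℤ) ⊕ content t)) →
      ∀ (f : ℤ³ → ℤ) → ∑ patterns (f ∘ swap ∘ content) ≡ ∑ patterns (f ∘ content)
    ∑-patterns-flip flip swap flip-involutive flip-interlacing content-flip f = begin
      ∑ patterns (f ∘ swap ∘ content)   ≡⟨ ∑-cong patterns (λ {t} _ → cong f (sym (content-flip′ t))) ⟩
      ∑ patterns (f ∘ content ∘ flip)   ≡⟨ ∑-involution flip patterns-unique flip-into (f ∘ content) ⟩
      ∑ patterns (f ∘ content)          ∎
      where
      flip-into : ∀ {t} → t ∈ patterns → flip t ∈ patterns × flip (flip t) ≡ t
      flip-into {t} t∈ = from ∈-patterns (flip-interlacing (to ∈-patterns t∈)) , flip-involutive t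
      content-flip′ : ∀ t → content (flip t) ≡ swap (content t)
      content-flip′ t = begin
        content (flip t)                       ≡⟨ ⊕-identityˡ (content (flip t)) ⟨
        (0ℤ , 0ℤ , 0ℤ) ⊕ content (flip t)      ≡⟨ content-flip t ⟩
        swap ((0ℤ , 0ℤ , 0ℤ) ⊕ content t)      ≡⟨ cong swap (⊕-identityˡ (content t)) ⟩
        swap (content t)                       ∎

  ∑-patterns-swap₁₂ : ∀ (f : ℤ³ → ℤ) → ∑ patterns (f ∘ swap₁₂ ∘ content) ≡ ∑ patterns (f ∘ content)
  ∑-patterns-swap₁₂ = ∑-patterns-flip (flip-i 0ℤ) swap₁₂ (flip-i-involutive 0ℤ)
    (λ { {a , _ , i} t-interlacing@(_ , _ , (_ , i≤a)) →
         proj₁ (flip-i-interlacing ℤₚ.≤-refl t-interlacing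
           (subst (i ≤_) (sym (ℤₚ.+-identityʳ a)) i≤a)) })
    (content-flip-i 0ℤ 0ℤ 0ℤ)

  ∑-patterns-swap₂₃ : ∀ (f : ℤ³ → ℤ) → ∑ patterns (f ∘ swap₂₃ ∘ content) ≡ ∑ patterns (f ∘ content)
  ∑-patterns-swap₂₃ = ∑-patterns-flip (flip-ab 0ℤ) swap₂₃ (flip-ab-involutive 0ℤ)
    (λ { {a , _ , _} t-interlacing@((_ , a≤m₁) , _) →
         proj₁ (flip-ab-interlacing ℤₚ.≤-refl t-interlacing
           (subst (a ≤_) (sym (ℤₚ.+-identityʳ m₁)) a≤m₁)) })
    (content-flip-ab 0ℤ 0ℤ 0ℤ)

  module LatticeWords (k₁ k₂ k₃ : ℤ) where

    private
      k : ℤ³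
      k = k₁ , k₂ , k₃

    -- Row r of the tableau is read from right to left. Latticeᵣₑ says that, once its entries e have
    -- been read, k + the content of the part read so far is still strictly decreasing.
    Lattice₁₃ Lattice₁₂ Lattice₂₃ : ℤ³ → Set
    Lattice₁₃ (a , b , i) = k₃ + (m₁ - a) < k₂
    Lattice₁₂ (a , b , i) = k₂ + (a - i) < k₁
    Lattice₂₃ (a , b , i) = k₃ + (m₁ - a) + (m₂ - b) < k₂ + (a - i)

    private
      lattice₁₃? : ∀ t → Dec (Lattice₁₃ t)
      lattice₁₃? (a , b , i) = k₃ + (m₁ - a) <? k₂

      lattice₁₂? : ∀ t → Dec (Lattice₁₂ t)
      lattice₁₂? (a , b , i) = k₂ + (a - i) <? k₁

      lattice₂₃? : ∀ t → Dec (Lattice₂₃ t)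
      lattice₂₃? (a , b , i) = k₃ + (m₁ - a) + (m₂ - b) <? k₂ + (a - i)

      patterns₁₃ patterns₁₂ : List ℤ³
      patterns₁₃ = filter lattice₁₃? patterns
      patterns₁₂ = filter lattice₁₂? patterns₁₃

      patterns₁₃-unique : Unique patterns₁₃
      patterns₁₃-unique = Uniqueₚ.filter⁺ lattice₁₃? patterns-unique

      patterns₁₂-unique : Unique patterns₁₂
      patterns₁₂-unique = Uniqueₚ.filter⁺ lattice₁₂? patterns₁₃-unique

    latticePatterns : List ℤ³
    latticePatterns = filter lattice₂₃? patterns₁₂

    latticePatterns-unique : Unique latticePatterns
    latticePatterns-unique = Uniqueₚ.filter⁺ lattice₂₃? patterns₁₂-unique

    Lattice : ℤ³ → Set
    Lattice t = Interlacing t × Lattice₁₃ t × Lattice₁₂ t × Lattice₂₃ t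

    ∈-latticePatterns : ∀ {t} → t ∈ latticePatterns ⇔ Lattice t
    ∈-latticePatterns {t} = mk⇔ sound λ (t-interlacing , l₁₃ , l₁₂ , l₂₃) →
      ∈-filter⁺ lattice₂₃? (∈-filter⁺ lattice₁₂? (∈-filter⁺ lattice₁₃?
        (from ∈-patterns t-interlacing) l₁₃) l₁₂) l₂₃
      where
      sound : t ∈ latticePatterns → Lattice t
      sound t∈latticePatterns =
        let t∈₁₂ , l₂₃ = ∈-filter⁻ lattice₂₃? {xs = patterns₁₂} t∈latticePatterns
            t∈₁₃ , l₁₂ = ∈-filter⁻ lattice₁₂? {xs = patterns₁₃} t∈₁₂
            t∈ , l₁₃ = ∈-filter⁻ lattice₁₃? {xs = patterns} t∈₁₃
        in to ∈-patterns t∈ , l₁₃ , l₁₂ , l₂₃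

    lattice⇒strictlyDecreasing : ∀ {t} → Lattice t → StrictlyDecreasing (k ⊕ content t)
    lattice⇒strictlyDecreasing {a , b , i} ((_ , (m₃≤b , _) , (b≤i , _)) , _ , l₁₂ , l₂₃) =
        subst (_< k₁ + i) (first k₂ a b i) (ℤₚ.+-mono-<-≤ l₁₂ b≤i)
      , subst₂ _<_ (third k₃ m₁ m₂ m₃ a b) (first k₂ a b i) (ℤₚ.+-mono-<-≤ l₂₃ m₃≤b)
      where
      first : ∀ k₂ a b i → k₂ + (a - i) + b ≡ k₂ + (a + b - i)
      first = solve-∀
      third : ∀ k₃ m₁ m₂ m₃ a b → k₃ + (m₁ - a) + (m₂ - b) + m₃ ≡ k₃ + (m₁ + m₂ + m₃ - (a + b))
      third = solve-∀

    module _ {F : ℤ³ → ℤ} (F-antisymmetric : Antisymmetric F) (k₂≤k₁ : k₂ ≤ k₁) (k₃≤k₂ : k₃ ≤ k₂) where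
      private
        f : ℤ³ → ℤ
        f t = F (k ⊕ content t)

        0≤k₁-k₂ : 0ℤ ≤ k₁ - k₂
        0≤k₁-k₂ = ℤₚ.i≤j⇒0≤j-i k₂≤k₁
        0≤k₂-k₃ : 0ℤ ≤ k₂ - k₃
        0≤k₂-k₃ = ℤₚ.i≤j⇒0≤j-i k₃≤k₂

        ¬lattice₁₃ : ∀ ((a , b , i) : ℤ³) → (¬ Lattice₁₃ (a , b , i)) ⇔ a ≤ m₁ - (k₂ - k₃)
        ¬lattice₁₃ (a , b , i) = ≮⇔≤ (regroup m₁ k₂ k₃ a)
          where
          regroup : ∀ m₁ k₂ k₃ a → k₃ + (m₁ - a) - k₂ ≡ m₁ - (k₂ - k₃) - a
          regroup = solve-∀

        ¬lattice₁₂ : ∀ ((a , b , i) : ℤ³) → (¬ Lattice₁₂ (a , b , i)) ⇔ i ≤ a - (k₁ - k₂)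
        ¬lattice₁₂ (a , b , i) = ≮⇔≤ (regroup k₁ k₂ a i)
          where
          regroup : ∀ k₁ k₂ a i → k₂ + (a - i) - k₁ ≡ a - (k₁ - k₂) - i
          regroup = solve-∀

        ¬lattice₂₃ : ∀ ((a , b , i) : ℤ³) → (¬ Lattice₂₃ (a , b , i)) ⇔ b ≤ b-bound (k₂ - k₃) a i
        ¬lattice₂₃ (a , b , i) = ≮⇔≤ (regroup m₁ m₂ k₂ k₃ a b i)
          where
          regroup : ∀ m₁ m₂ k₂ k₃ a b i →
            k₃ + (m₁ - a) + (m₂ - b) - (k₂ + (a - i)) ≡ m₁ + m₂ + i - (k₂ - k₃) - (a + a) - b
          regroup = solve-∀

        cancel₁₃ : ∑ patterns f ≡ ∑ patterns₁₃ f
        cancel₁₃ = ∑-cancel lattice₁₃? (flip-ab (k₂ - k₃)) patterns-unique λ {t} t∈ ¬l₁₃ →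
            closed t∈ ¬l₁₃
          , flip-ab-involutive (k₂ - k₃) t
          , trans (cong F (content-flip-ab k₁ k₂ k₃ t)) (proj₂ F-antisymmetric _)
          where
          closed : ∀ {t} → t ∈ patterns → ¬ Lattice₁₃ t →
            flip-ab (k₂ - k₃) t ∈ patterns × ¬ Lattice₁₃ (flip-ab (k₂ - k₃) t)
          closed {a , b , i} t∈ ¬l₁₃ =
            let flipped , a′≤ = flip-ab-interlacing 0≤k₂-k₃ (to ∈-patterns t∈)
                              (to (¬lattice₁₃ (a , b , i)) ¬l₁₃)
            in from ∈-patterns flipped , from (¬lattice₁₃ (flip-ab (k₂ - k₃) (a , b , i))) a′≤

        cancel₁₂ : ∑ patterns₁₃ f ≡ ∑ patterns₁₂ f
        cancel₁₂ = ∑-cancel lattice₁₂? (flip-i (k₁ - k₂)) patterns₁₃-unique λ {t} t∈ ¬l₁₂ →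
            closed t∈ ¬l₁₂
          , flip-i-involutive (k₁ - k₂) t
          , trans (cong F (content-flip-i k₁ k₂ k₃ t)) (proj₁ F-antisymmetric _)
          where
          closed : ∀ {t} → t ∈ patterns₁₃ → ¬ Lattice₁₂ t →
            flip-i (k₁ - k₂) t ∈ patterns₁₃ × ¬ Lattice₁₂ (flip-i (k₁ - k₂) t)
          closed {a , b , i} t∈₁₃ ¬l₁₂ =
            let t∈ , l₁₃ = ∈-filter⁻ lattice₁₃? {xs = patterns} t∈₁₃
                flipped , i′≤ = flip-i-interlacing 0≤k₁-k₂ (to ∈-patterns t∈)
                              (to (¬lattice₁₂ (a , b , i)) ¬l₁₂)
            in ∈-filter⁺ lattice₁₃? (from ∈-patterns flipped) l₁₃
             , from (¬lattice₁₂ (flip-i (k₁ - k₂) (a , b , i))) i′≤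

        cancel₂₃ : ∑ patterns₁₂ f ≡ ∑ latticePatterns f
        cancel₂₃ = ∑-cancel lattice₂₃? (flip-b (k₂ - k₃)) patterns₁₂-unique λ {t} t∈ ¬l₂₃ →
            closed t∈ ¬l₂₃
          , flip-b-involutive (k₂ - k₃) t
          , trans (cong F (content-flip-b k₁ k₂ k₃ t)) (proj₂ F-antisymmetric _)
          where
          closed : ∀ {t} → t ∈ patterns₁₂ → ¬ Lattice₂₃ t →
            flip-b (k₂ - k₃) t ∈ patterns₁₂ × ¬ Lattice₂₃ (flip-b (k₂ - k₃) t)
          closed {a , b , i} t∈₁₂ ¬l₂₃ =
            let t∈₁₃ , l₁₂ = ∈-filter⁻ lattice₁₂? {xs = patterns₁₃} t∈₁₂
                t∈ , l₁₃ = ∈-filter⁻ lattice₁₃? {xs = patterns} t∈₁₃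
                flipped , b′≤ = flip-b-interlacing (to ∈-patterns t∈)
                              (≤-fromDifference (ℤₚ.<⇒≤ l₁₃) (gap m₁ k₂ k₃ a))
                              (to (¬lattice₂₃ (a , b , i)) ¬l₂₃)
            in ∈-filter⁺ lattice₁₂? (∈-filter⁺ lattice₁₃? (from ∈-patterns flipped) l₁₃) l₁₂
             , from (¬lattice₂₃ (flip-b (k₂ - k₃) (a , b , i))) b′≤
            where
            gap : ∀ m₁ k₂ k₃ a → k₂ - (k₃ + (m₁ - a)) ≡ a - (m₁ - (k₂ - k₃))
            gap = solve-∀

      ∑-patterns-lattice :
        ∑[ t ∈ patterns ] F (k ⊕ content t) ≡ ∑[ t ∈ latticePatterns ] F (k ⊕ content t)
      ∑-patterns-lattice = trans cancel₁₃ (trans cancel₁₂ cancel₂₃)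

  -- For k = ρ the tableau with all entries of row j equal to j is the only one that survives.
  ∑-patterns-ρ : ∀ {F} → Antisymmetric F → m₂ ≤ m₁ → m₃ ≤ m₂ →
    ∑[ t ∈ patterns ] F (ρ ⊕ content t) ≡ F (ρ ⊕ (m₁ , m₂ , m₃))
  ∑-patterns-ρ {F} F-antisymmetric m₂≤m₁ m₃≤m₂ = begin
    ∑[ t ∈ patterns ] F (ρ ⊕ content t)
      ≡⟨ ∑-patterns-lattice F-antisymmetric (ℤ.+≤+ (s≤s z≤n)) (ℤ.+≤+ z≤n) ⟩
    ∑[ t ∈ latticePatterns ] F (ρ ⊕ content t)
      ≡⟨ cong (λ ts → ∑ ts (λ t → F (ρ ⊕ content t))) (Unique⇒singleton latticePatterns-unique
           (from ∈-latticePatterns highest-lattice) (forced ∘ to ∈-latticePatterns)) ⟩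
    F (ρ ⊕ content highest) + 0ℤ
      ≡⟨ ℤₚ.+-identityʳ _ ⟩
    F (ρ ⊕ content highest)
      ≡⟨ cong (λ p → F (ρ ⊕ p)) content-highest ⟩
    F (ρ ⊕ (m₁ , m₂ , m₃)) ∎
    where
    open LatticeWords (+ 2) (+ 1) (+ 0)
    highest : ℤ³
    highest = m₁ , m₂ , m₁
    content-highest : content highest ≡ (m₁ , m₂ , m₃)
    content-highest = triple-≡ refl (second m₁ m₂) (third m₁ m₂ m₃)
      where
      second : ∀ m₁ m₂ → m₁ + m₂ - m₁ ≡ m₂
      second = solve-∀
      third : ∀ m₁ m₂ m₃ → m₁ + m₂ + m₃ - (m₁ + m₂) ≡ m₃
      third = solve-∀
    lattice₁₃⇔ : ∀ {a b i} → Lattice₁₃ (a , b , i) ⇔ m₁ ≤ a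
    lattice₁₃⇔ {a} = <⇔≤ (gap m₁ a)
      where
      gap : ∀ m₁ a → + 1 - (1ℤ + (+ 0 + (m₁ - a))) ≡ a - m₁
      gap = solve-∀
    lattice₁₂⇔ : ∀ {a b i} → Lattice₁₂ (a , b , i) ⇔ a ≤ i
    lattice₁₂⇔ {a} {i = i} = <⇔≤ (gap a i)
      where
      gap : ∀ a i → + 2 - (1ℤ + (+ 1 + (a - i))) ≡ i - a
      gap = solve-∀
    lattice₂₃⇔ : ∀ {a b i} → Lattice₂₃ (a , b , i) ⇔ m₁ + i + m₂ ≤ a + a + b
    lattice₂₃⇔ {a} {b} {i} = <⇔≤ (gap m₁ m₂ a b i)
      where
      gap : ∀ m₁ m₂ a b i →
        + 1 + (a - i) - (1ℤ + (+ 0 + (m₁ - a) + (m₂ - b))) ≡ a + a + b - (m₁ + i + m₂)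
      gap = solve-∀
    highest-lattice : Lattice highest
    highest-lattice =
        ((m₂≤m₁ , ℤₚ.≤-refl) , (m₃≤m₂ , ℤₚ.≤-refl) , (m₂≤m₁ , ℤₚ.≤-refl))
      , from (lattice₁₃⇔ {m₁} {m₂} {m₁}) ℤₚ.≤-refl
      , from (lattice₁₂⇔ {m₁} {m₂} {m₁}) ℤₚ.≤-refl
      , from (lattice₂₃⇔ {m₁} {m₂} {m₁}) ℤₚ.≤-refl
    forced : ∀ {t} → Lattice t → t ≡ highest
    forced {a , b , i} (((_ , a≤m₁) , (_ , b≤m₂) , (_ , i≤a)) , l₁₃ , l₁₂ , l₂₃) =
      triple-≡ a≡m₁ (ℤₚ.≤-antisym b≤m₂ m₂≤b) (trans (ℤₚ.≤-antisym i≤a a≤i) a≡m₁)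
      where
      a≡m₁ : a ≡ m₁
      a≡m₁ = ℤₚ.≤-antisym a≤m₁ (to (lattice₁₃⇔ {a} {b} {i}) l₁₃)
      a≤i : a ≤ i
      a≤i = to (lattice₁₂⇔ {a} {b} {i}) l₁₂
      m₂≤b : m₂ ≤ b
      m₂≤b = ≤-fromDifference (ℤₚ.+-mono-≤ (to (lattice₂₃⇔ {a} {b} {i}) l₂₃) (ℤₚ.+-mono-≤ a≤m₁ a≤i))
        (gap m₁ m₂ a b i)
        where
        gap : ∀ m₁ m₂ a b i → a + a + b + (m₁ + i) - (m₁ + i + m₂ + (a + a)) ≡ b - m₂
        gap = solve-∀

-- Fillings

words-unique : ∀ n k → Unique (words n k)
words-unique n zero    = [] ∷ []
words-unique n (suc k) =
  Uniqueₚ.cartesianProductWith⁺ _∷_ Listₚ.∷-injective (Uniqueₚ.allFin⁺ n) (words-unique n k)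

∈-words : ∀ {n} (w : List (Fin n)) → w ∈ words n (length w)
∈-words []      = here refl
∈-words (i ∷ w) = ∈-cartesianProductWith⁺ _∷_ (∈-allFin i) (∈-words w)

∈-words⇒length≡ : ∀ {n} k {w : List (Fin n)} → w ∈ words n k → length w ≡ k
∈-words⇒length≡     zero    (here refl) = refl
∈-words⇒length≡ {n} (suc k) w∈
  with _ , _ , _ , w′∈ , refl ← ∈-cartesianProductWith⁻ _∷_ (allFin n) (words n k) w∈ =
  cong suc (∈-words⇒length≡ k w′∈)

fillings-unique : ∀ n ps → Unique (fillings n ps)
fillings-unique n []       = [] ∷ []
fillings-unique n (p ∷ ps) =
  Uniqueₚ.cartesianProductWith⁺ _∷_ Listₚ.∷-injective (words-unique n p) (fillings-unique n ps)

∈-fillings : ∀ {n} (T : Filling n) → T ∈ fillings n (map length T)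
∈-fillings []      = here refl
∈-fillings (r ∷ T) = ∈-cartesianProductWith⁺ _∷_ (∈-words r) (∈-fillings T)

∈-fillings⇒shape≡ : ∀ {n} ps {T : Filling n} → T ∈ fillings n ps → map length T ≡ ps
∈-fillings⇒shape≡     []       (here refl) = refl
∈-fillings⇒shape≡ {n} (p ∷ ps) T∈
  with _ , _ , r∈ , T′∈ , refl ← ∈-cartesianProductWith⁻ _∷_ (words n p) (fillings n ps) T∈ =
  cong₂ _∷_ (∈-words⇒length≡ p r∈) (∈-fillings⇒shape≡ ps T′∈)

tableaux : ∀ n → List ℕ → List (Filling n)
tableaux n ps = filter semiStandard? (fillings n ps)

∈-tableaux : ∀ {n ps} {T : Filling n} → T ∈ tableaux n ps ⇔ (map length T ≡ ps × SemiStandard T)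
∈-tableaux {n} {ps} {T} = mk⇔
  (λ T∈ → let T∈fillings , ss = ∈-filter⁻ semiStandard? {xs = fillings n ps} T∈
          in ∈-fillings⇒shape≡ ps T∈fillings , ss)
  (λ { (refl , ss) → ∈-filter⁺ semiStandard? (∈-fillings T) ss })

-- The first column is strictly increasing.
height≤n : ∀ {n} {T : Filling n} → All (λ r → 0 ℕ.< length r) T → Linked _Above_ T → length T ℕ.≤ n
height≤n []                    _      = z≤n
height≤n {n} {T = (i ∷ _) ∷ _} nonempty linked =
  ℕₚ.≤-trans (ℕₚ.m≤n+m _ (Fin.toℕ i)) (corner+height≤n nonempty linked)
  where
  corner+height≤n : ∀ {i : Fin n} {r T} →
    All (λ r → 0 ℕ.< length r) ((i ∷ r) ∷ T) → Linked _Above_ ((i ∷ r) ∷ T) →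
    Fin.toℕ i ℕ.+ suc (length T) ℕ.≤ n
  corner+height≤n {i} _ [-] = subst (ℕ._≤ n) (ℕₚ.+-comm 1 _) (Finₚ.toℕ<n i)
  corner+height≤n {T = [] ∷ _} (_ ∷ () ∷ _) _
  corner+height≤n {i} {T = (j ∷ _) ∷ T} (_ ∷ nonempty) ((i<j ∷ _) ∷ linked) =
    ℕₚ.≤-trans (subst (ℕ._≤ Fin.toℕ j ℕ.+ suc (length T)) (sym (ℕₚ.+-suc _ _)) (ℕₚ.+-monoˡ-≤ _ i<j))
               (corner+height≤n nonempty linked)

∑-schur-tall : ∀ n κ → ¬ (ℓ κ ℕ.≤ n) → ∀ f → ∑ (schur n κ) f ≡ 0ℤ
∑-schur-tall n κ ℓ≰n f = begin
  ∑ (schur n κ) f            ≡⟨ ∑-map weight (ssyt n κ) f ⟩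
  ∑ (ssyt n κ) (f ∘ weight)  ≡⟨ ∑-cong (ssyt n κ) (λ T∈ → contradiction (ℓ≤n (to ∈-tableaux T∈)) ℓ≰n) ⟩
  ∑[ _ ∈ ssyt n κ ] 0ℤ       ≡⟨ ∑-zero (ssyt n κ) ⟩
  0ℤ                         ∎
  where
  ℓ≤n : ∀ {T : Filling n} → map length T ≡ parts κ × SemiStandard T → ℓ κ ℕ.≤ n
  ℓ≤n {T} (shape , (_ , linked)) = subst (ℕ._≤ n) length≡ℓ
    (height≤n (Allₚ.map⁻ (subst (All (0 ℕ.<_)) (sym shape) (positive κ))) linked)
    where
    length≡ℓ : length T ≡ ℓ κ
    length≡ℓ = trans (sym (Listₚ.length-map length T)) (cong length shape)

∑-fillings-∷ʳ-0 : ∀ n ps (f : Filling n → ℤ) →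
  ∑ (fillings n (ps ∷ʳ 0)) f ≡ ∑[ T ∈ fillings n ps ] f (T ∷ʳ [])
∑-fillings-∷ʳ-0 n []       f = refl
∑-fillings-∷ʳ-0 n (p ∷ ps) f = begin
  ∑ (fillings n (p ∷ ps ∷ʳ 0)) f
    ≡⟨ ∑-cartesianProductWith _∷_ (words n p) (fillings n (ps ∷ʳ 0)) f ⟩
  ∑[ r ∈ words n p ] ∑[ T ∈ fillings n (ps ∷ʳ 0) ] f (r ∷ T)
    ≡⟨ ∑-cong (words n p) (λ {r} _ → ∑-fillings-∷ʳ-0 n ps (f ∘ (r ∷_))) ⟩
  ∑[ r ∈ words n p ] ∑[ T ∈ fillings n ps ] f (r ∷ T ∷ʳ [])
    ≡⟨ ∑-cartesianProductWith _∷_ (words n p) (fillings n ps) (λ T → f (T ∷ʳ [])) ⟨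
  ∑[ T ∈ fillings n (p ∷ ps) ] f (T ∷ʳ []) ∎

semiStandard-∷ʳ-[] : ∀ {n} {T : Filling n} → SemiStandard (T ∷ʳ []) ⇔ SemiStandard T
semiStandard-∷ʳ-[] {n} = mk⇔
  (λ (sorted , linked) → Allₚ.++⁻ˡ _ sorted , unpadded linked)
  (λ (sorted , linked) → Allₚ.++⁺ sorted ([] ∷ []) , padded linked)
  where
  above-[] : ∀ (r : List (Fin n)) → r Above []
  above-[] []      = []
  above-[] (_ ∷ _) = []
  padded : ∀ {T : Filling n} → Linked _Above_ T → Linked _Above_ (T ∷ʳ [])
  padded []               = [-]
  padded {r ∷ []} [-]     = above-[] r ∷ [-]
  padded (above ∷ linked) = above ∷ padded linked
  unpadded : ∀ {T : Filling n} → Linked _Above_ (T ∷ʳ []) → Linked _Above_ T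
  unpadded {[]}        _                = []
  unpadded {_ ∷ []}    _                = [-]
  unpadded {_ ∷ _ ∷ _} (above ∷ linked) = above ∷ unpadded linked

∑-tableaux-∷ʳ-0 : ∀ n ps (f : Vec ℕ n → ℤ) →
  ∑ (tableaux n (ps ∷ʳ 0)) (f ∘ weight) ≡ ∑ (tableaux n ps) (f ∘ weight)
∑-tableaux-∷ʳ-0 n ps f = begin
  ∑ (tableaux n (ps ∷ʳ 0)) (f ∘ weight)
    ≡⟨ ∑-filter semiStandard? (fillings n (ps ∷ʳ 0)) _ ⟩
  ∑[ T ∈ fillings n (ps ∷ʳ 0) ] 𝟙 (semiStandard? T) * f (weight T)
    ≡⟨ ∑-fillings-∷ʳ-0 n ps _ ⟩
  ∑[ T ∈ fillings n ps ] 𝟙 (semiStandard? (T ∷ʳ [])) * f (weight (T ∷ʳ []))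
    ≡⟨ ∑-cong (fillings n ps) (λ {T} _ → cong₂ (λ s α → s * f α)
         (𝟙-cong (semiStandard? (T ∷ʳ [])) (semiStandard? T) semiStandard-∷ʳ-[]) (weight-∷ʳ-[] T)) ⟩
  ∑[ T ∈ fillings n ps ] 𝟙 (semiStandard? T) * f (weight T)
    ≡⟨ ∑-filter semiStandard? (fillings n ps) _ ⟨
  ∑ (tableaux n ps) (f ∘ weight) ∎
  where
  weight-∷ʳ-[] : ∀ (T : Filling n) → weight (T ∷ʳ []) ≡ weight T
  weight-∷ʳ-[] T = cong (λ w → Vec.tabulate (λ i → length (filter (i Fin.≟_) w)))
    (trans (sym (Listₚ.concat-++ T ([] ∷ []))) (Listₚ.++-identityʳ (concat T)))

∑-tableaux-++-zeros : ∀ n ps k (f : Vec ℕ n → ℤ) →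
  ∑ (tableaux n (ps ++ replicate k 0)) (f ∘ weight) ≡ ∑ (tableaux n ps) (f ∘ weight)
∑-tableaux-++-zeros n ps zero    f =
  cong (λ qs → ∑ (tableaux n qs) (f ∘ weight)) (Listₚ.++-identityʳ ps)
∑-tableaux-++-zeros n ps (suc k) f = begin
  ∑ (tableaux n (ps ++ 0 ∷ replicate k 0)) (f ∘ weight)
    ≡⟨ cong (λ qs → ∑ (tableaux n qs) (f ∘ weight)) (Listₚ.∷ʳ-++ ps 0 (replicate k 0)) ⟨
  ∑ (tableaux n (ps ∷ʳ 0 ++ replicate k 0)) (f ∘ weight)
    ≡⟨ ∑-tableaux-++-zeros n (ps ∷ʳ 0) k f ⟩
  ∑ (tableaux n (ps ∷ʳ 0)) (f ∘ weight)
    ≡⟨ ∑-tableaux-∷ʳ-0 n ps f ⟩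
  ∑ (tableaux n ps) (f ∘ weight) ∎

∑-schur-padded : ∀ κ → ℓ κ ℕ.≤ 3 → ∀ f →
  ∑ (schur 3 κ) f ≡ ∑ (tableaux 3 (κ ₁ ∷ κ ₂ ∷ κ ₃ ∷ [])) (f ∘ weight)
∑-schur-padded κ ℓ≤3 f = trans (∑-map weight (ssyt 3 κ) f) (padded (parts κ) ℓ≤3)
  where
  padded : ∀ ps → length ps ℕ.≤ 3 →
    ∑ (tableaux 3 ps) (f ∘ weight) ≡ ∑ (tableaux 3 (nth ps 0 ∷ nth ps 1 ∷ nth ps 2 ∷ [])) (f ∘ weight)
  padded []                  _ = sym (∑-tableaux-++-zeros 3 [] 3 f)
  padded (p ∷ [])            _ = sym (∑-tableaux-++-zeros 3 (p ∷ []) 2 f)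
  padded (p ∷ q ∷ [])        _ = sym (∑-tableaux-++-zeros 3 (p ∷ q ∷ []) 1 f)
  padded (p ∷ q ∷ r ∷ [])    _ = refl
  padded (_ ∷ _ ∷ _ ∷ _ ∷ _) (s≤s (s≤s (s≤s ())))

-- Tableaux with entries in {1,2,3}

row : ℕ → ℕ → ℕ → List (Fin 3)
row c d e = replicate c 0F ++ replicate d 1F ++ replicate e 2F

length-row : ∀ c d e → length (row c d e) ≡ c ℕ.+ (d ℕ.+ e)
length-row (suc c) d       e       = cong suc (length-row c d e)
length-row zero    (suc d) e       = cong suc (length-row 0 d e)
length-row zero    zero    e       = Listₚ.length-replicate e

row-sorted : ∀ c d e → Linked Fin._≤_ (row c d e)
row-sorted (suc c) d e = 0F∷ (row-sorted c d e)
  where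
  0F∷ : ∀ {w : List (Fin 3)} → Linked Fin._≤_ w → Linked Fin._≤_ (0F ∷ w)
  0F∷ {[]}    _      = [-]
  0F∷ {_ ∷ _} sorted = z≤n ∷ sorted
row-sorted zero zero          zero          = []
row-sorted zero zero          (suc zero)    = [-]
row-sorted zero zero          (suc (suc e)) = s≤s (s≤s z≤n) ∷ row-sorted 0 0 (suc e)
row-sorted zero (suc zero)    zero          = [-]
row-sorted zero (suc zero)    (suc e)       = s≤s z≤n ∷ row-sorted 0 0 (suc e)
row-sorted zero (suc (suc d)) e             = s≤s z≤n ∷ row-sorted 0 (suc d) e

sorted⇒row : ∀ {w} → Linked Fin._≤_ w → ∃[ c ] ∃[ d ] ∃[ e ] w ≡ row c d e
sorted⇒row []                = 0 , 0 , 0 , refl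
sorted⇒row {0F ∷ []} [-]     = 1 , 0 , 0 , refl
sorted⇒row {1F ∷ []} [-]     = 0 , 1 , 0 , refl
sorted⇒row {2F ∷ []} [-]     = 0 , 0 , 1 , refl
sorted⇒row {i ∷ _ ∷ _} (i≤j ∷ sorted) with i | i≤j | sorted⇒row sorted
... | 0F | _   | c     , d     , e , eq   = suc c , d , e , cong (0F ∷_) eq
... | 1F | _   | 0     , d     , e , eq   = 0 , suc d , e , cong (1F ∷_) eq
... | 1F | ()  | suc _ , _     , _ , refl
... | 2F | _   | 0     , 0     , e , eq   = 0 , 0 , suc e , cong (2F ∷_) eq
... | 2F | s≤s () | 0  , suc _ , _ , refl
... | 2F | ()  | suc _ , _     , _ , refl

Above-row : ∀ c d e c′ d′ e′ → c′ ℕ.+ (d′ ℕ.+ e′) ℕ.≤ c ℕ.+ (d ℕ.+ e) →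
  row c d e Above row c′ d′ e′ ⇔ (c′ ≡ 0 × d′ ℕ.≤ c × d′ ℕ.+ e′ ℕ.≤ c ℕ.+ d)
Above-row c d e c′ d′ e′ shorter = mk⇔ (above⇒ c d e c′ d′ e′ shorter)
  λ { (refl , d′≤c , d′+e′≤c+d) → ⇒above c d e d′ e′ d′≤c d′+e′≤c+d }
  where
  above⇒ : ∀ c d e c′ d′ e′ → c′ ℕ.+ (d′ ℕ.+ e′) ℕ.≤ c ℕ.+ (d ℕ.+ e) →
    row c d e Above row c′ d′ e′ → c′ ≡ 0 × d′ ℕ.≤ c × d′ ℕ.+ e′ ℕ.≤ c ℕ.+ d
  above⇒ (suc c) d       e       (suc c′) d′       e′       _ (() ∷ _)
  above⇒ zero    (suc d) e       (suc c′) d′       e′       _ (() ∷ _)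
  above⇒ zero    zero    (suc e) (suc c′) d′       e′       _ (() ∷ _)
  above⇒ c       d       e       zero     zero     zero     _ _       = refl , z≤n , z≤n
  above⇒ (suc c) d       e       zero     zero     (suc e′) (s≤s shorter) (_ ∷ above) =
    let _ , _ , e′≤c+d = above⇒ c d e 0 0 e′ shorter above in refl , z≤n , s≤s e′≤c+d
  above⇒ zero    (suc d) e       zero     zero     (suc e′) (s≤s shorter) (_ ∷ above) =
    let _ , _ , e′≤d = above⇒ 0 d e 0 0 e′ shorter above in refl , z≤n , s≤s e′≤d
  above⇒ zero    zero    (suc e) zero     zero     (suc e′) _ (s≤s (s≤s ()) ∷ _)
  above⇒ (suc c) d       e       zero     (suc d′) e′       (s≤s shorter) (_ ∷ above) =
    let _ , d′≤c , d′+e′≤c+d = above⇒ c d e 0 d′ e′ shorter above in refl , s≤s d′≤c , s≤s d′+e′≤c+d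
  above⇒ zero    (suc d) e       zero     (suc d′) e′       _ (s≤s () ∷ _)
  above⇒ zero    zero    (suc e) zero     (suc d′) e′       _ (s≤s () ∷ _)
  ⇒above : ∀ c d e d′ e′ → d′ ℕ.≤ c → d′ ℕ.+ e′ ℕ.≤ c ℕ.+ d → row c d e Above row 0 d′ e′
  ⇒above zero    zero    zero    zero     zero     _          _        = []
  ⇒above zero    zero    (suc e) zero     zero     _          _        = []
  ⇒above zero    (suc d) e       zero     zero     _          _        = []
  ⇒above (suc c) d       e       zero     zero     _          _        = []
  ⇒above (suc c) d       e       zero     (suc e′) _          (s≤s e′≤) =
    s≤s z≤n ∷ ⇒above c d e 0 e′ z≤n e′≤
  ⇒above zero    (suc d) e       zero     (suc e′) _          (s≤s e′≤) =
    s≤s (s≤s z≤n) ∷ ⇒above 0 d e 0 e′ z≤n e′≤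
  ⇒above (suc c) d       e       (suc d′) e′       (s≤s d′≤c) (s≤s d′+e′≤) =
    s≤s z≤n ∷ ⇒above c d e d′ e′ d′≤c d′+e′≤

count : ∀ {n} → Fin n → List (Fin n) → ℕ
count i w = length (filter (i Fin.≟_) w)

count-++ : ∀ {n} (i : Fin n) v w → count i (v ++ w) ≡ count i v ℕ.+ count i w
count-++ i v w =
  trans (cong length (Listₚ.filter-++ (i Fin.≟_) v w)) (Listₚ.length-++ (filter (i Fin.≟_) v))

count-row : ∀ c d e i → count i (row c d e) ≡ Vec.lookup (c ∷ d ∷ e ∷ []) i
count-row (suc c) d       e       0F = cong suc (count-row c d e 0F)
count-row (suc c) d       e       1F = count-row c d e 1F
count-row (suc c) d       e       2F = count-row c d e 2F
count-row zero    (suc d) e       0F = count-row 0 d e 0F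
count-row zero    (suc d) e       1F = cong suc (count-row 0 d e 1F)
count-row zero    (suc d) e       2F = count-row 0 d e 2F
count-row zero    zero    (suc e) 0F = count-row 0 0 e 0F
count-row zero    zero    (suc e) 1F = count-row 0 0 e 1F
count-row zero    zero    (suc e) 2F = cong suc (count-row 0 0 e 2F)
count-row zero    zero    zero    0F = refl
count-row zero    zero    zero    1F = refl
count-row zero    zero    zero    2F = refl

data ThreeRowed : (p₁ p₂ p₃ : ℕ) → Filling 3 → Set where
  three-rowed : ∀ c d e x y z → x ℕ.≤ c → x ℕ.+ y ℕ.≤ c ℕ.+ d → z ℕ.≤ x →
    ThreeRowed (c ℕ.+ (d ℕ.+ e)) (x ℕ.+ y) z (row c d e ∷ row 0 x y ∷ row 0 0 z ∷ [])

∈-tableaux₃ : ∀ {p₁ p₂ p₃ T} → p₂ ℕ.≤ p₁ → p₃ ℕ.≤ p₂ →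
  T ∈ tableaux 3 (p₁ ∷ p₂ ∷ p₃ ∷ []) ⇔ ThreeRowed p₁ p₂ p₃ T
∈-tableaux₃ p₂≤p₁ p₃≤p₂ =
  mk⇔ (uncurry (classify p₂≤p₁ p₃≤p₂) ∘ to ∈-tableaux) (from ∈-tableaux ∘ semiStandard)
  where
  classify : ∀ {p₁ p₂ p₃ T} → p₂ ℕ.≤ p₁ → p₃ ℕ.≤ p₂ →
    map length T ≡ p₁ ∷ p₂ ∷ p₃ ∷ [] → SemiStandard T → ThreeRowed p₁ p₂ p₃ T
  classify {T = _ ∷ _ ∷ _ ∷ []} p₂≤p₁ p₃≤p₂ refl
           (sorted₁ ∷ sorted₂ ∷ sorted₃ ∷ [] , above₁₂ ∷ above₂₃ ∷ [-])
    with c , d , e , refl ← sorted⇒row sorted₁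
       | c′ , x , y , refl ← sorted⇒row sorted₂
       | c″ , x′ , z , refl ← sorted⇒row sorted₃
    rewrite length-row c d e | length-row c′ x y | length-row c″ x′ z
    with refl , x≤c , x+y≤c+d ← to (Above-row c d e c′ x y p₂≤p₁) above₁₂
    with refl , z≤n , z≤x ← to (Above-row 0 x y c″ x′ z p₃≤p₂) above₂₃
    = three-rowed c d e x y z x≤c x+y≤c+d z≤x
  semiStandard : ∀ {p₁ p₂ p₃ T} → ThreeRowed p₁ p₂ p₃ T →
    map length T ≡ p₁ ∷ p₂ ∷ p₃ ∷ [] × SemiStandard T
  semiStandard (three-rowed c d e x y z x≤c x+y≤c+d z≤x) =
      cong₂ _∷_ (length-row c d e) (cong₂ _∷_ (length-row 0 x y) (cong (_∷ []) (length-row 0 0 z)))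
    , row-sorted c d e ∷ row-sorted 0 x y ∷ row-sorted 0 0 z ∷ []
    , from (Above-row c d e 0 x y (ℕₚ.≤-trans x+y≤c+d (ℕₚ.+-monoʳ-≤ c (ℕₚ.m≤m+n d e))))
        (refl , x≤c , x+y≤c+d)
    ∷ from (Above-row 0 x y 0 0 z (ℕₚ.≤-trans z≤x (ℕₚ.m≤m+n x y))) (refl , z≤n , z≤x)
    ∷ [-]

toℤ³ : Vec ℕ 3 → ℤ³
toℤ³ (x ∷ y ∷ z ∷ []) = + x , + y , + z

weight-three-rowed : ∀ c d e x y z →
  toℤ³ (weight (row c d e ∷ row 0 x y ∷ row 0 0 z ∷ [])) ≡ (+ c , + (d ℕ.+ x) , + (e ℕ.+ (y ℕ.+ z)))
weight-three-rowed c d e x y z = triple-≡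
  (cong +_ (trans (total 0F) (ℕₚ.+-identityʳ c)))
  (cong +_ (trans (total 1F) (cong (d ℕ.+_) (ℕₚ.+-identityʳ x))))
  (cong +_ (total 2F))
  where
  total : ∀ i → count i (concat (row c d e ∷ row 0 x y ∷ row 0 0 z ∷ [])) ≡
    Vec.lookup (c ∷ d ∷ e ∷ []) i ℕ.+ (Vec.lookup (0 ∷ x ∷ y ∷ []) i ℕ.+ Vec.lookup (0 ∷ 0 ∷ z ∷ []) i)
  total i = begin
    count i (row c d e ++ row 0 x y ++ row 0 0 z ++ [])
      ≡⟨ cong (λ w → count i (row c d e ++ row 0 x y ++ w)) (Listₚ.++-identityʳ (row 0 0 z)) ⟩
    count i (row c d e ++ row 0 x y ++ row 0 0 z)
      ≡⟨ trans (count-++ i (row c d e) _) (cong (count i (row c d e) ℕ.+_) (count-++ i (row 0 x y) _)) ⟩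
    count i (row c d e) ℕ.+ (count i (row 0 x y) ℕ.+ count i (row 0 0 z))
      ≡⟨ cong₂ ℕ._+_ (count-row c d e i) (cong₂ ℕ._+_ (count-row 0 x y i) (count-row 0 0 z i)) ⟩
    _ ∎

gtPattern : Filling 3 → ℤ³
gtPattern (u ∷ v ∷ _) = + (count 0F u ℕ.+ count 1F u) , + count 1F v , + count 0F u
gtPattern _           = 0ℤ , 0ℤ , 0ℤ

gtPattern-rows : ∀ c d e x y T → gtPattern (row c d e ∷ row 0 x y ∷ T) ≡ (+ (c ℕ.+ d) , + x , + c)
gtPattern-rows c d e x y T = triple-≡
  (cong +_ (cong₂ ℕ._+_ (count-row c d e 0F) (count-row c d e 1F)))
  (cong +_ (count-row 0 x y 1F))
  (cong +_ (count-row c d e 0F))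

module _ {p₁ p₂ p₃ : ℕ} (p₂≤p₁ : p₂ ℕ.≤ p₁) (p₃≤p₂ : p₃ ℕ.≤ p₂) where
  open GelfandTsetlin (+ p₁) (+ p₂) (+ p₃)

  private
    shape : List ℕ
    shape = p₁ ∷ p₂ ∷ p₃ ∷ []

    tableau : ℤ³ → Filling 3
    tableau (a , b , i) = rows (∣ a ∣) (∣ b ∣) (∣ i ∣)
      where
      rows : (a b i : ℕ) → Filling 3
      rows a b i = row i (a ℕ.∸ i) (p₁ ℕ.∸ a) ∷ row 0 b (p₂ ℕ.∸ b) ∷ row 0 0 p₃ ∷ []

    gtPattern-interlacing : ∀ {p₁ p₂ p₃ T} → ThreeRowed p₁ p₂ p₃ T →
      GelfandTsetlin.Interlacing (+ p₁) (+ p₂) (+ p₃) (gtPattern T)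
    gtPattern-interlacing (three-rowed c d e x y z x≤c x+y≤c+d z≤x)
      = subst (GelfandTsetlin.Interlacing _ _ _) (sym (gtPattern-rows c d e x y (row 0 0 z ∷ [])))
      ( (ℤ.+≤+ x+y≤c+d , ℤ.+≤+ (ℕₚ.+-monoʳ-≤ c (ℕₚ.m≤m+n d e)))
      , (ℤ.+≤+ z≤x , ℤ.+≤+ (ℕₚ.m≤m+n x y))
      , (ℤ.+≤+ x≤c , ℤ.+≤+ (ℕₚ.m≤m+n c d)))

    content-gtPattern : ∀ {p₁ p₂ p₃ T} → ThreeRowed p₁ p₂ p₃ T →
      GelfandTsetlin.content (+ p₁) (+ p₂) (+ p₃) (gtPattern T) ≡ toℤ³ (weight T)
    content-gtPattern (three-rowed c d e x y z _ _ _) = begin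
      content′ (gtPattern (row c d e ∷ row 0 x y ∷ row 0 0 z ∷ []))
        ≡⟨ cong content′ (gtPattern-rows c d e x y (row 0 0 z ∷ [])) ⟩
      content′ (+ (c ℕ.+ d) , + x , + c)
        ≡⟨ triple-≡ refl (second (+ c) (+ d) (+ x)) (third (+ c) (+ d) (+ e) (+ x) (+ y) (+ z)) ⟩
      (+ c , + (d ℕ.+ x) , + (e ℕ.+ (y ℕ.+ z)))
        ≡⟨ weight-three-rowed c d e x y z ⟨
      toℤ³ (weight (row c d e ∷ row 0 x y ∷ row 0 0 z ∷ [])) ∎
      where
      content′ : ℤ³ → ℤ³
      content′ = GelfandTsetlin.content (+ (c ℕ.+ (d ℕ.+ e))) (+ (x ℕ.+ y)) (+ z)
      second : ∀ c d x → c + d + x - c ≡ d + x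
      second = solve-∀
      third : ∀ c d e x y z → c + (d + e) + (x + y) + z - (c + d + x) ≡ e + (y + z)
      third = solve-∀

    tableau-gtPattern : ∀ {T} → ThreeRowed p₁ p₂ p₃ T → tableau (gtPattern T) ≡ T
    tableau-gtPattern (three-rowed c d e x y z _ _ _)
      rewrite cong tableau (gtPattern-rows c d e x y (row 0 0 z ∷ []))
            | ℕₚ.m+n∸m≡n c d | sym (ℕₚ.+-assoc c d e) | ℕₚ.m+n∸m≡n (c ℕ.+ d) e | ℕₚ.m+n∸m≡n x y = refl

    tableau-three-rowed : ∀ {t} → Interlacing t →
      ThreeRowed p₁ p₂ p₃ (tableau t) × gtPattern (tableau t) ≡ t
    tableau-three-rowed {+ a , + b , + i}
      ((ℤ.+≤+ p₂≤a , ℤ.+≤+ a≤p₁) , (ℤ.+≤+ p₃≤b , ℤ.+≤+ b≤p₂) , (ℤ.+≤+ b≤i , ℤ.+≤+ i≤a))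
      = subst₂ (λ q₁ q₂ → ThreeRowed q₁ q₂ p₃ (tableau (+ a , + b , + i))) row₁ b+[p₂∸b]≡p₂
          (three-rowed i (a ℕ.∸ i) (p₁ ℕ.∸ a) b (p₂ ℕ.∸ b) p₃ b≤i
            (subst₂ ℕ._≤_ (sym b+[p₂∸b]≡p₂) (sym i+[a∸i]≡a) p₂≤a) p₃≤b)
      , trans (gtPattern-rows i (a ℕ.∸ i) (p₁ ℕ.∸ a) b (p₂ ℕ.∸ b) (row 0 0 p₃ ∷ []))
              (triple-≡ (cong +_ i+[a∸i]≡a) refl refl)
      where
      i+[a∸i]≡a : i ℕ.+ (a ℕ.∸ i) ≡ a
      i+[a∸i]≡a = ℕₚ.m+[n∸m]≡n i≤a
      b+[p₂∸b]≡p₂ : b ℕ.+ (p₂ ℕ.∸ b) ≡ p₂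
      b+[p₂∸b]≡p₂ = ℕₚ.m+[n∸m]≡n b≤p₂
      row₁ : i ℕ.+ (a ℕ.∸ i ℕ.+ (p₁ ℕ.∸ a)) ≡ p₁
      row₁ = begin
        i ℕ.+ (a ℕ.∸ i ℕ.+ (p₁ ℕ.∸ a))   ≡⟨ ℕₚ.+-assoc i (a ℕ.∸ i) (p₁ ℕ.∸ a) ⟨
        i ℕ.+ (a ℕ.∸ i) ℕ.+ (p₁ ℕ.∸ a)   ≡⟨ cong (ℕ._+ (p₁ ℕ.∸ a)) i+[a∸i]≡a ⟩
        a ℕ.+ (p₁ ℕ.∸ a)                 ≡⟨ ℕₚ.m+[n∸m]≡n a≤p₁ ⟩
        p₁                               ∎

  ∑-tableaux-patterns : ∀ (f : ℤ³ → ℤ) →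
    ∑[ T ∈ tableaux 3 shape ] f (toℤ³ (weight T)) ≡ ∑ patterns (f ∘ content)
  ∑-tableaux-patterns f = begin
    ∑[ T ∈ tableaux 3 shape ] f (toℤ³ (weight T))
      ≡⟨ ∑-cong (tableaux 3 shape) (λ T∈ → cong f (sym (content-gtPattern (rows T∈)))) ⟩
    ∑[ T ∈ tableaux 3 shape ] f (content (gtPattern T))
      ≡⟨ ∑-reindex gtPattern tableau
           (Uniqueₚ.filter⁺ semiStandard? (fillings-unique 3 shape)) patterns-unique
           (λ T∈ → from ∈-patterns (gtPattern-interlacing (rows T∈)) , tableau-gtPattern (rows T∈))
           (λ t∈ → let T-rows , inverse = tableau-three-rowed (to ∈-patterns t∈)
                   in from (∈-tableaux₃ p₂≤p₁ p₃≤p₂) T-rows , inverse)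
           (f ∘ content) ⟩
    ∑ patterns (f ∘ content) ∎
    where
    rows : ∀ {T} → T ∈ tableaux 3 shape → ThreeRowed p₁ p₂ p₃ T
    rows = to (∈-tableaux₃ p₂≤p₁ p₃≤p₂)

nth-antitone : ∀ {ps} → Linked ℕ._≥_ ps → ∀ i → nth ps (suc i) ℕ.≤ nth ps i
nth-antitone []            i       = z≤n
nth-antitone [-]           i       = z≤n
nth-antitone (p≥q ∷ _)     zero    = p≥q
nth-antitone (_ ∷ ps↘)     (suc i) = nth-antitone ps↘ i

nth-beyond : ∀ ps {i} → length ps ℕ.≤ i → nth ps i ≡ 0
nth-beyond []       _            = refl
nth-beyond (_ ∷ ps) (s≤s ps≤i)   = nth-beyond ps ps≤i

nth-injective : ∀ {ps qs} → All (0 ℕ.<_) ps → All (0 ℕ.<_) qs → (∀ i → nth ps i ≡ nth qs i) → ps ≡ qs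
nth-injective []        []        eq = refl
nth-injective []        (0<q ∷ _) eq = contradiction (eq 0) (ℕₚ.<⇒≢ 0<q)
nth-injective (0<p ∷ _) []        eq = contradiction (sym (eq 0)) (ℕₚ.<⇒≢ 0<p)
nth-injective (_ ∷ 0<ps) (_ ∷ 0<qs) eq = cong₂ _∷_ (eq 0) (nth-injective 0<ps 0<qs (eq ∘ suc))

parts³ : Partition → ℤ³
parts³ κ = + κ ₁ , + κ ₂ , + κ ₃

parts³-injective : ∀ {κ κ′} → ℓ κ ℕ.≤ 3 → ℓ κ′ ℕ.≤ 3 → parts³ κ ≡ parts³ κ′ → parts κ ≡ parts κ′
parts³-injective {κ} {κ′} κ≤3 κ′≤3 eq = nth-injective (positive κ) (positive κ′) nth≡
  where
  nth≡ : ∀ i → nth (parts κ) i ≡ nth (parts κ′) i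
  nth≡ 0 = ℤₚ.+-injective (cong proj₁ eq)
  nth≡ 1 = ℤₚ.+-injective (cong (proj₁ ∘ proj₂) eq)
  nth≡ 2 = ℤₚ.+-injective (cong (proj₂ ∘ proj₂) eq)
  nth≡ (suc (suc (suc i))) = trans (nth-beyond (parts κ) (ℕₚ.≤-trans κ≤3 3≤3+i))
    (sym (nth-beyond (parts κ′) (ℕₚ.≤-trans κ′≤3 3≤3+i)))
    where
    3≤3+i : 3 ℕ.≤ 3 ℕ.+ i
    3≤3+i = ℕₚ.m≤m+n 3 i

ρ⊕parts³-strictlyDecreasing : ∀ κ → StrictlyDecreasing (ρ ⊕ parts³ κ)
ρ⊕parts³-strictlyDecreasing κ =
    ℤ.+<+ (s≤s (s≤s (nth-antitone (decreasing κ) 0)))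
  , ℤ.+<+ (s≤s (nth-antitone (decreasing κ) 1))

module SchurPatterns (κ : Partition) = GelfandTsetlin (+ κ ₁) (+ κ ₂) (+ κ ₃)

∑-schur-patterns : ∀ κ → ℓ κ ℕ.≤ 3 → ∀ (f : ℤ³ → ℤ) → let open SchurPatterns κ in
  ∑ (schur 3 κ) (f ∘ toℤ³) ≡ ∑ patterns (f ∘ content)
∑-schur-patterns κ κ≤3 f =
  trans (∑-schur-padded κ κ≤3 (f ∘ toℤ³))
        (∑-tableaux-patterns (nth-antitone (decreasing κ) 0) (nth-antitone (decreasing κ) 1) f)

schur-antisymmetric : ∀ κ → ℓ κ ℕ.≤ 3 → ∀ {F} → Antisymmetric F →
  Antisymmetric (λ p → ∑[ α ∈ schur 3 κ ] F (p ⊕ toℤ³ α))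
schur-antisymmetric κ κ≤3 {F} (F-swap₁₂ , F-swap₂₃) =
    swapped swap₁₂ (λ _ _ → refl) ∑-patterns-swap₁₂ F-swap₁₂
  , swapped swap₂₃ (λ _ _ → refl) ∑-patterns-swap₂₃ F-swap₂₃
  where
  open SchurPatterns κ
  swapped : ∀ swap → (∀ p q → swap p ⊕ swap q ≡ swap (p ⊕ q)) →
    (∀ (f : ℤ³ → ℤ) → ∑ patterns (f ∘ swap ∘ content) ≡ ∑ patterns (f ∘ content)) →
    (∀ p → F (swap p) ≡ - F p) → ∀ p →
    ∑[ α ∈ schur 3 κ ] F (swap p ⊕ toℤ³ α) ≡ - (∑[ α ∈ schur 3 κ ] F (p ⊕ toℤ³ α))
  swapped swap swap-⊕ ∑-swapped F-swap p = begin
    ∑[ α ∈ schur 3 κ ] F (swap p ⊕ toℤ³ α)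
      ≡⟨ ∑-schur-patterns κ κ≤3 (λ q → F (swap p ⊕ q)) ⟩
    ∑[ t ∈ patterns ] F (swap p ⊕ content t)
      ≡⟨ ∑-swapped (λ q → F (swap p ⊕ q)) ⟨
    ∑[ t ∈ patterns ] F (swap p ⊕ swap (content t))
      ≡⟨ ∑-cong patterns (λ {t} _ → trans (cong F (swap-⊕ p (content t))) (F-swap (p ⊕ content t))) ⟩
    ∑[ t ∈ patterns ] (- F (p ⊕ content t))
      ≡⟨ ∑-neg patterns (λ t → F (p ⊕ content t)) ⟩
    - (∑[ t ∈ patterns ] F (p ⊕ content t))
      ≡⟨ cong -_ (∑-schur-patterns κ κ≤3 (λ q → F (p ⊕ q))) ⟨
    - (∑[ α ∈ schur 3 κ ] F (p ⊕ toℤ³ α)) ∎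

∑-schur-ρ : ∀ κ → ℓ κ ℕ.≤ 3 → ∀ {F} → Antisymmetric F →
  ∑[ α ∈ schur 3 κ ] F (ρ ⊕ toℤ³ α) ≡ F (ρ ⊕ parts³ κ)
∑-schur-ρ κ κ≤3 {F} F-antisymmetric = trans (∑-schur-patterns κ κ≤3 (λ q → F (ρ ⊕ q)))
  (SchurPatterns.∑-patterns-ρ κ F-antisymmetric
    (ℤ.+≤+ (nth-antitone (decreasing κ) 0)) (ℤ.+≤+ (nth-antitone (decreasing κ) 1)))

∑-schur-⊗-ρ : ∀ μ ν → ℓ μ ℕ.≤ 3 → ℓ ν ℕ.≤ 3 → ∀ {F} → Antisymmetric F →
  ∑[ γ ∈ schur 3 μ ⊗ schur 3 ν ] F (ρ ⊕ toℤ³ γ) ≡ ∑[ α ∈ schur 3 μ ] F (ρ ⊕ parts³ ν ⊕ toℤ³ α)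
∑-schur-⊗-ρ μ ν μ≤3 ν≤3 {F} F-antisymmetric = begin
  ∑[ γ ∈ schur 3 μ ⊗ schur 3 ν ] F (ρ ⊕ toℤ³ γ)
    ≡⟨ ∑-cartesianProductWith (Vec.zipWith ℕ._+_) (schur 3 μ) (schur 3 ν) _ ⟩
  ∑[ α ∈ schur 3 μ ] ∑[ β ∈ schur 3 ν ] F (ρ ⊕ toℤ³ (Vec.zipWith ℕ._+_ α β))
    ≡⟨ ∑-cong (schur 3 μ) (λ {α} _ → ∑-cong (schur 3 ν) (λ {β} _ → cong F (regroup α β))) ⟩
  ∑[ α ∈ schur 3 μ ] ∑[ β ∈ schur 3 ν ] F (ρ ⊕ toℤ³ β ⊕ toℤ³ α)
    ≡⟨ ∑-swap (schur 3 μ) (schur 3 ν) _ ⟩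
  ∑[ β ∈ schur 3 ν ] ∑[ α ∈ schur 3 μ ] F (ρ ⊕ toℤ³ β ⊕ toℤ³ α)
    ≡⟨ ∑-schur-ρ ν ν≤3 (schur-antisymmetric μ μ≤3 F-antisymmetric) ⟩
  ∑[ α ∈ schur 3 μ ] F (ρ ⊕ parts³ ν ⊕ toℤ³ α) ∎
  where
  regroup : ∀ (α β : Vec ℕ 3) → ρ ⊕ toℤ³ (Vec.zipWith ℕ._+_ α β) ≡ ρ ⊕ toℤ³ β ⊕ toℤ³ α
  regroup α@(_ ∷ _ ∷ _ ∷ []) β@(_ ∷ _ ∷ _ ∷ []) =
    trans (cong (ρ ⊕_) (⊕-comm (toℤ³ α) (toℤ³ β))) (sym (⊕-assoc ρ (toℤ³ β) (toℤ³ α)))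

-- For symmetric p, ∑[ α ∈ p ] alternant (ρ + λ) (ρ + α) is the coefficient of x^(λ+ρ) in a_ρ p.
alternant : ℤ³ → ℤ³ → ℤ
alternant q = antisymmetrize (λ p → 𝟙 (p ≟³ q))

alternant-antisymmetric : ∀ q → Antisymmetric (alternant q)
alternant-antisymmetric q = antisymmetrize-antisymmetric (λ p → 𝟙 (p ≟³ q))

alternant-dominant : ∀ {p q} → StrictlyDecreasing p → StrictlyDecreasing q → alternant q p ≡ 𝟙 (p ≟³ q)
alternant-dominant {q = q} p↘ q↘ = antisymmetrize-chamber (λ p → 𝟙 (p ≟³ q))
  (λ p p↘̸ → 𝟙-no (p ≟³ q) (λ { refl → p↘̸ q↘ })) p↘

sameParts? : ∀ lam κ → Dec (parts lam ≡ parts κ)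
sameParts? lam κ = Listₚ.≡-dec ℕ._≟_ (parts lam) (parts κ)

schur-orthonormal : ∀ lam κ → ℓ lam ℕ.≤ 3 →
  ∑[ α ∈ schur 3 κ ] alternant (ρ ⊕ parts³ lam) (ρ ⊕ toℤ³ α) ≡ 𝟙 (sameParts? lam κ)
schur-orthonormal lam κ lam≤3 with ℓ κ ℕ.≤? 3
... | no κ≰3 = trans (∑-schur-tall 3 κ κ≰3 _)
  (sym (𝟙-no (sameParts? lam κ) λ eq → κ≰3 (subst (λ ps → length ps ℕ.≤ 3) eq lam≤3)))
... | yes κ≤3 = begin
  ∑[ α ∈ schur 3 κ ] alternant (ρ ⊕ parts³ lam) (ρ ⊕ toℤ³ α)
    ≡⟨ ∑-schur-ρ κ κ≤3 (alternant-antisymmetric (ρ ⊕ parts³ lam)) ⟩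
  alternant (ρ ⊕ parts³ lam) (ρ ⊕ parts³ κ)
    ≡⟨ alternant-dominant (ρ⊕parts³-strictlyDecreasing κ) (ρ⊕parts³-strictlyDecreasing lam) ⟩
  𝟙 ((ρ ⊕ parts³ κ) ≟³ (ρ ⊕ parts³ lam))
    ≡⟨ 𝟙-cong ((ρ ⊕ parts³ κ) ≟³ (ρ ⊕ parts³ lam)) (sameParts? lam κ) (mk⇔
         (λ eq → parts³-injective {lam} {κ} lam≤3 κ≤3 (sym (⊕-cancelˡ ρ eq)))
         (λ eq → cong (λ ps → ρ ⊕ (+ nth ps 0 , + nth ps 1 , + nth ps 2)) (sym eq))) ⟩
  𝟙 (sameParts? lam κ) ∎

-- Littlewood–Richardson rule

module _ (lam μ ν : Partition) where
  open SchurPatterns μ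
  open LatticeWords (+ 2 + + ν ₁) (+ 1 + + ν ₂) (+ 0 + + ν ₃)

  private
    weight? : ∀ t → Dec (ρ ⊕ parts³ ν ⊕ content t ≡ ρ ⊕ parts³ lam)
    weight? t = (ρ ⊕ parts³ ν ⊕ content t) ≟³ (ρ ⊕ parts³ lam)

  lrPatterns : List ℤ³
  lrPatterns = filter weight? latticePatterns

  lrPatterns-unique : Unique lrPatterns
  lrPatterns-unique = Uniqueₚ.filter⁺ weight? latticePatterns-unique

  ∈-lrPatterns : ∀ {t} → t ∈ lrPatterns ⇔ (Lattice t × ρ ⊕ parts³ ν ⊕ content t ≡ ρ ⊕ parts³ lam)
  ∈-lrPatterns = mk⇔
    (λ t∈ → let t∈lattice , eq = ∈-filter⁻ weight? {xs = latticePatterns} t∈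
            in to ∈-latticePatterns t∈lattice , eq)
    (λ (t-lattice , eq) → ∈-filter⁺ weight? (from ∈-latticePatterns t-lattice) eq)

  littlewood-richardson : ℓ lam ℕ.≤ 3 → ℓ μ ℕ.≤ 3 → ℓ ν ℕ.≤ 3 →
    ∀ {c} → IsLRCoefficient lam μ ν c → c ≡ + length lrPatterns
  littlewood-richardson lam≤3 μ≤3 ν≤3 {c} (L , expansion , refl) = begin
    coeffAt lam L
      ≡⟨ ∑-filter (sameParts? lam ∘ proj₂) L proj₁ ⟩
    ∑[ t ∈ L ] 𝟙 (sameParts? lam (proj₂ t)) * proj₁ t
      ≡⟨ ∑-cong L (λ {t} _ → trans (ℤₚ.*-comm (𝟙 (sameParts? lam (proj₂ t))) (proj₁ t))
           (cong (proj₁ t *_) (sym (schur-orthonormal lam (proj₂ t) lam≤3)))) ⟩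
    ∑[ t ∈ L ] proj₁ t * (∑[ α ∈ schur 3 (proj₂ t) ] F (ρ ⊕ toℤ³ α))
      ≡⟨ ∑-schurExpansion (schur 3 μ ⊗ schur 3 ν) L (expansion 3) _ ⟨
    ∑[ γ ∈ schur 3 μ ⊗ schur 3 ν ] F (ρ ⊕ toℤ³ γ)
      ≡⟨ ∑-schur-⊗-ρ μ ν μ≤3 ν≤3 F-antisymmetric ⟩
    ∑[ α ∈ schur 3 μ ] F (ρ ⊕ parts³ ν ⊕ toℤ³ α)
      ≡⟨ ∑-schur-patterns μ μ≤3 (λ q → F (ρ ⊕ parts³ ν ⊕ q)) ⟩
    ∑[ t ∈ patterns ] F (ρ ⊕ parts³ ν ⊕ content t)
      ≡⟨ ∑-patterns-lattice F-antisymmetric (ℤₚ.<⇒≤ (proj₁ k↘)) (ℤₚ.<⇒≤ (proj₂ k↘)) ⟩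
    ∑[ t ∈ latticePatterns ] F (ρ ⊕ parts³ ν ⊕ content t)
      ≡⟨ ∑-cong latticePatterns (λ t∈ → alternant-dominant
           (lattice⇒strictlyDecreasing (to ∈-latticePatterns t∈)) (ρ⊕parts³-strictlyDecreasing lam)) ⟩
    ∑[ t ∈ latticePatterns ] 𝟙 (weight? t)
      ≡⟨ length-filter≡∑ weight? latticePatterns ⟨
    + length lrPatterns ∎
    where
    F : ℤ³ → ℤ
    F = alternant (ρ ⊕ parts³ lam)
    F-antisymmetric : Antisymmetric F
    F-antisymmetric = alternant-antisymmetric (ρ ⊕ parts³ lam)
    k↘ : StrictlyDecreasing (ρ ⊕ parts³ ν)
    k↘ = ρ⊕parts³-strictlyDecreasing ν

-- Hives

module Hive (l₁ l₂ l₃ m₁ m₂ m₃ n₁ n₂ n₃ : ℤ) where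
  open import Data.Integer using (_≤_; _<_)
  open GelfandTsetlin m₁ m₂ m₃
  open LatticeWords (+ 2 + n₁) (+ 1 + n₂) (+ 0 + n₃) public
    using (Lattice; Lattice₁₃; Lattice₁₂; Lattice₂₃)

  lower : Fin 6 → ℤ
  lower 0F = m₂
  lower 1F = l₁ + l₂ - n₁ - n₂ - m₂
  lower 2F = l₁ - n₁
  lower 3F = l₂ - n₂
  lower 4F = m₁ + n₃ - n₂
  lower 5F = m₁ + m₂ + n₃ - l₂

  upper : Fin 3 → ℤ
  upper 0F = m₁
  upper 1F = l₁ + l₂ - n₁ - n₂ - m₃
  upper 2F = l₁ - n₂

  open Bounds lower upper public

  SameSize : Set
  SameSize = l₁ + l₂ + l₃ ≡ m₁ + m₂ + m₃ + (n₁ + n₂ + n₃)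

  HasWeight : ℤ³ → Set
  HasWeight t = ρ ⊕ (n₁ , n₂ , n₃) ⊕ content t ≡ ρ ⊕ (l₁ , l₂ , l₃)

  -- The content of a pattern of weight λ - ν determines i and a + b.
  fiber : ℤ → ℤ³
  fiber a = a , l₁ + l₂ - n₁ - n₂ - a , l₁ - n₁

  hasWeight⇒fiber : ∀ t → HasWeight t → SameSize × t ≡ fiber (proj₁ t)
  hasWeight⇒fiber (a , b , i) weight = sameSize , triple-≡ refl b≡ i≡
    where
    n⊕content≡l : (n₁ , n₂ , n₃) ⊕ content (a , b , i) ≡ (l₁ , l₂ , l₃)
    n⊕content≡l = ⊕-cancelˡ ρ (trans (sym (⊕-assoc ρ (n₁ , n₂ , n₃) (content (a , b , i)))) weight)
    n₁+i≡l₁ : n₁ + i ≡ l₁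
    n₁+i≡l₁ = cong proj₁ n⊕content≡l
    n₂+[a+b-i]≡l₂ : n₂ + (a + b - i) ≡ l₂
    n₂+[a+b-i]≡l₂ = cong (proj₁ ∘ proj₂) n⊕content≡l
    n₃+[m-a-b]≡l₃ : n₃ + (m₁ + m₂ + m₃ - (a + b)) ≡ l₃
    n₃+[m-a-b]≡l₃ = cong (proj₂ ∘ proj₂) n⊕content≡l
    i≡ : i ≡ l₁ - n₁
    i≡ = trans (regroup n₁ i) (cong (_- n₁) n₁+i≡l₁)
      where
      regroup : ∀ n₁ i → i ≡ n₁ + i - n₁
      regroup = solve-∀
    b≡ : b ≡ l₁ + l₂ - n₁ - n₂ - a
    b≡ = trans (regroup n₁ n₂ a b i) (cong₂ (λ x y → x + y - n₁ - n₂ - a) n₁+i≡l₁ n₂+[a+b-i]≡l₂)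
      where
      regroup : ∀ n₁ n₂ a b i → b ≡ n₁ + i + (n₂ + (a + b - i)) - n₁ - n₂ - a
      regroup = solve-∀
    sameSize : SameSize
    sameSize = trans (sym (cong₂ _+_ (cong₂ _+_ n₁+i≡l₁ n₂+[a+b-i]≡l₂) n₃+[m-a-b]≡l₃))
      (regroup m₁ m₂ m₃ n₁ n₂ n₃ a b i)
      where
      regroup : ∀ m₁ m₂ m₃ n₁ n₂ n₃ a b i →
        n₁ + i + (n₂ + (a + b - i)) + (n₃ + (m₁ + m₂ + m₃ - (a + b))) ≡ m₁ + m₂ + m₃ + (n₁ + n₂ + n₃)
      regroup = solve-∀

  fiber-hasWeight : SameSize → ∀ a → HasWeight (fiber a)
  fiber-hasWeight sameSize a = triple-≡ (first l₁ n₁) (second l₁ l₂ n₁ n₂ a) (begin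
    + 0 + n₃ + (m₁ + m₂ + m₃ - (a + (l₁ + l₂ - n₁ - n₂ - a)))
      ≡⟨ regroup l₁ l₂ m₁ m₂ m₃ n₁ n₂ n₃ a ⟩
    + 0 + (m₁ + m₂ + m₃ + (n₁ + n₂ + n₃) - l₁ - l₂)
      ≡⟨ cong (λ s → + 0 + (s - l₁ - l₂)) sameSize ⟨
    + 0 + (l₁ + l₂ + l₃ - l₁ - l₂)
      ≡⟨ cong (_+_ (+ 0)) (cancel l₁ l₂ l₃) ⟩
    + 0 + l₃ ∎)
    where
    first : ∀ l₁ n₁ → + 2 + n₁ + (l₁ - n₁) ≡ + 2 + l₁
    first = solve-∀
    second : ∀ l₁ l₂ n₁ n₂ a → + 1 + n₂ + (a + (l₁ + l₂ - n₁ - n₂ - a) - (l₁ - n₁)) ≡ + 1 + l₂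
    second = solve-∀
    regroup : ∀ l₁ l₂ m₁ m₂ m₃ n₁ n₂ n₃ a →
      + 0 + n₃ + (m₁ + m₂ + m₃ - (a + (l₁ + l₂ - n₁ - n₂ - a))) ≡
      + 0 + (m₁ + m₂ + m₃ + (n₁ + n₂ + n₃) - l₁ - l₂)
    regroup = solve-∀
    cancel : ∀ l₁ l₂ l₃ → l₁ + l₂ + l₃ - l₁ - l₂ ≡ l₃
    cancel = solve-∀

  fiber-lattice⇔between : ∀ a → Lattice (fiber a) ⇔ Between a
  fiber-lattice⇔between a = mk⇔
    (λ (((m₂≤a , a≤m₁) , (m₃≤b , b≤m₂) , (b≤i , i≤a)) , lattice₁₃ , lattice₁₂ , lattice₂₃) →
        (λ { 0F → m₂≤a
           ; 1F → to b≤m₂⇔ b≤m₂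
           ; 2F → i≤a
           ; 3F → to b≤i⇔ b≤i
           ; 4F → to lattice₁₃⇔ lattice₁₃
           ; 5F → to lattice₂₃⇔ lattice₂₃ })
      , (λ { 0F → a≤m₁
           ; 1F → to m₃≤b⇔ m₃≤b
           ; 2F → to lattice₁₂⇔ lattice₁₂ }))
    (λ (lower≤a , a≤upper) →
        ( (lower≤a 0F , a≤upper 0F)
        , (from m₃≤b⇔ (a≤upper 1F) , from b≤m₂⇔ (lower≤a 1F))
        , (from b≤i⇔ (lower≤a 3F) , lower≤a 2F))
      , from lattice₁₃⇔ (lower≤a 4F)
      , from lattice₁₂⇔ (a≤upper 2F)
      , from lattice₂₃⇔ (lower≤a 5F))
    where
    b : ℤ
    b = l₁ + l₂ - n₁ - n₂ - a
    m₃≤b⇔ : m₃ ≤ b ⇔ a ≤ upper 1F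
    m₃≤b⇔ = ≤⇔≤ (gap l₁ l₂ m₃ n₁ n₂ a)
      where
      gap : ∀ l₁ l₂ m₃ n₁ n₂ a → l₁ + l₂ - n₁ - n₂ - a - m₃ ≡ l₁ + l₂ - n₁ - n₂ - m₃ - a
      gap = solve-∀
    b≤m₂⇔ : b ≤ m₂ ⇔ lower 1F ≤ a
    b≤m₂⇔ = ≤⇔≤ (gap l₁ l₂ m₂ n₁ n₂ a)
      where
      gap : ∀ l₁ l₂ m₂ n₁ n₂ a → m₂ - (l₁ + l₂ - n₁ - n₂ - a) ≡ a - (l₁ + l₂ - n₁ - n₂ - m₂)
      gap = solve-∀
    b≤i⇔ : b ≤ l₁ - n₁ ⇔ lower 3F ≤ a
    b≤i⇔ = ≤⇔≤ (gap l₁ l₂ n₁ n₂ a)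
      where
      gap : ∀ l₁ l₂ n₁ n₂ a → l₁ - n₁ - (l₁ + l₂ - n₁ - n₂ - a) ≡ a - (l₂ - n₂)
      gap = solve-∀
    lattice₁₃⇔ : Lattice₁₃ (fiber a) ⇔ lower 4F ≤ a
    lattice₁₃⇔ = <⇔≤ (gap m₁ n₂ n₃ a)
      where
      gap : ∀ m₁ n₂ n₃ a → + 1 + n₂ - (1ℤ + (+ 0 + n₃ + (m₁ - a))) ≡ a - (m₁ + n₃ - n₂)
      gap = solve-∀
    lattice₁₂⇔ : Lattice₁₂ (fiber a) ⇔ a ≤ upper 2F
    lattice₁₂⇔ = <⇔≤ (gap l₁ n₁ n₂ a)
      where
      gap : ∀ l₁ n₁ n₂ a → + 2 + n₁ - (1ℤ + (+ 1 + n₂ + (a - (l₁ - n₁)))) ≡ l₁ - n₂ - a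
      gap = solve-∀
    lattice₂₃⇔ : Lattice₂₃ (fiber a) ⇔ lower 5F ≤ a
    lattice₂₃⇔ = <⇔≤ (gap l₁ l₂ m₁ m₂ n₁ n₂ n₃ a)
      where
      gap : ∀ l₁ l₂ m₁ m₂ n₁ n₂ n₃ a →
        + 1 + n₂ + (a - (l₁ - n₁)) - (1ℤ + (+ 0 + n₃ + (m₁ - a) + (m₂ - (l₁ + l₂ - n₁ - n₂ - a)))) ≡
        a - (m₁ + m₂ + n₃ - l₂)
      gap = solve-∀

  ∃!-hive⇔∃!-between : ∃! _≡_ (λ t → Lattice t × HasWeight t) ⇔ (SameSize × ∃! _≡_ Between)
  ∃!-hive⇔∃!-between = mk⇔
    (λ { (t , (t-lattice , t-weight) , unique) →
           proj₁ (hasWeight⇒fiber t t-weight)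
         , proj₁ t
         , between t t-lattice t-weight
         , λ {b} b-between → cong proj₁ (unique (from (fiber-lattice⇔between b) b-between
             , fiber-hasWeight (proj₁ (hasWeight⇒fiber t t-weight)) b)) })
    (λ { (size , a , a-between , unique) →
           fiber a
         , (from (fiber-lattice⇔between a) a-between , fiber-hasWeight size a)
         , λ {t} (t-lattice , t-weight) → trans (cong fiber (unique (between t t-lattice t-weight)))
             (sym (proj₂ (hasWeight⇒fiber t t-weight))) })
    where
    between : ∀ t → Lattice t → HasWeight t → Between (proj₁ t)
    between t t-lattice t-weight =
      to (fiber-lattice⇔between (proj₁ t)) (subst Lattice (proj₂ (hasWeight⇒fiber t t-weight)) t-lattice)

  -- If |λ| = |μ| + |ν| and (i , j) is the k-th pair, then upper j - lower i is the slack of the k-th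
  -- Horn inequality.
  boundPairs : List (Fin 6 × Fin 3)
  boundPairs = (1F , 1F) ∷ (0F , 0F) ∷ (4F , 0F) ∷ (2F , 2F) ∷ (5F , 1F) ∷ (3F , 2F)
             ∷ (2F , 0F) ∷ (3F , 0F) ∷ (1F , 2F) ∷ (0F , 1F) ∷ (4F , 1F) ∷ (5F , 2F)
             ∷ (1F , 0F) ∷ (2F , 1F) ∷ (5F , 0F) ∷ (3F , 1F) ∷ (0F , 2F) ∷ (4F , 2F) ∷ []

  ∈-boundPairs : ∀ i j → (i , j) ∈ boundPairs
  ∈-boundPairs = from-yes (Finₚ.all? λ i → Finₚ.all? λ j → (i , j) ∈? boundPairs)

  boundDifference : Fin 6 × Fin 3 → ℤ
  boundDifference (i , j) = upper j - lower i

-- The bounds are written out because the ring solver does not unfold lower and upper.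
hornSlacks≡boundDifferences : ∀ l₁ l₂ l₃ m₁ m₂ m₃ n₁ n₂ n₃ →
  l₃ ≡ m₁ + m₂ + m₃ + (n₁ + n₂ + n₃) - l₁ - l₂ →
  let L₀ = m₂ ; L₁ = l₁ + l₂ - n₁ - n₂ - m₂ ; L₂ = l₁ - n₁ ; L₃ = l₂ - n₂
      L₄ = m₁ + n₃ - n₂ ; L₅ = m₁ + m₂ + n₃ - l₂
      U₀ = m₁ ; U₁ = l₁ + l₂ - n₁ - n₂ - m₃ ; U₂ = l₁ - n₂
  in Pointwise _≡_
    ( m₂ - m₃ ∷ m₁ - m₂ ∷ n₂ - n₃ ∷ n₁ - n₂ ∷ l₂ - l₃ ∷ l₁ - l₂
    ∷ m₁ + n₁ - l₁ ∷ m₁ + n₂ - l₂ ∷ m₂ + n₁ - l₂ ∷ m₁ + n₃ - l₃ ∷ m₂ + n₂ - l₃ ∷ m₃ + n₁ - l₃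
    ∷ l₃ - (m₃ + n₃) ∷ l₂ - (m₃ + n₂) ∷ l₂ - (m₂ + n₃)
    ∷ l₁ - (m₃ + n₁) ∷ l₁ - (m₂ + n₂) ∷ l₁ - (m₁ + n₃) ∷ [])
    ( U₁ - L₁ ∷ U₀ - L₀ ∷ U₀ - L₄ ∷ U₂ - L₂ ∷ U₁ - L₅ ∷ U₂ - L₃
    ∷ U₀ - L₂ ∷ U₀ - L₃ ∷ U₂ - L₁ ∷ U₁ - L₀ ∷ U₁ - L₄ ∷ U₂ - L₅
    ∷ U₀ - L₁ ∷ U₁ - L₂ ∷ U₀ - L₅ ∷ U₁ - L₃ ∷ U₂ - L₀ ∷ U₂ - L₄ ∷ [])
hornSlacks≡boundDifferences l₁ l₂ _ m₁ m₂ m₃ n₁ n₂ n₃ refl =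
    solve vars ∷ solve vars ∷ solve vars ∷ solve vars ∷ solve vars ∷ solve vars
  ∷ solve vars ∷ solve vars ∷ solve vars ∷ solve vars ∷ solve vars ∷ solve vars
  ∷ solve vars ∷ solve vars ∷ solve vars ∷ solve vars ∷ solve vars ∷ solve vars ∷ []
  where
  vars : List ℤ
  vars = l₁ ∷ l₂ ∷ m₁ ∷ m₂ ∷ m₃ ∷ n₁ ∷ n₂ ∷ n₃ ∷ []

module PartitionHive (lam μ ν : Partition) =
  Hive (+ lam ₁) (+ lam ₂) (+ lam ₃) (+ μ ₁) (+ μ ₂) (+ μ ₃) (+ ν ₁) (+ ν ₂) (+ ν ₃)

module _ (lam μ ν : Partition) where
  open import Data.Integer using (_≤_)
  open PartitionHive lam μ ν

  private
    slack : ℕ × ℕ → ℤ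
    slack (x , y) = + y - + x

    slacks≡ : SameSize → map slack (hornInequalities lam μ ν) ≡ map boundDifference boundPairs
    slacks≡ size = Pointwise-≡⇒≡
      (hornSlacks≡boundDifferences (+ lam ₁) (+ lam ₂) (+ lam ₃)
        (+ μ ₁) (+ μ ₂) (+ μ ₃) (+ ν ₁) (+ ν ₂) (+ ν ₃)
        (trans (regroup (+ lam ₁) (+ lam ₂) (+ lam ₃)) (cong (λ s → s - + lam ₁ - + lam ₂) size)))
      where
      regroup : ∀ l₁ l₂ l₃ → l₃ ≡ l₁ + l₂ + l₃ - l₁ - l₂
      regroup = solve-∀

  consistent⇔horn : SameSize → Consistent ⇔ All (uncurry ℕ._≤_) (hornInequalities lam μ ν)
  consistent⇔horn size = mk⇔
    (λ consistent → All.map (λ 0≤slack → ℤₚ.drop‿+≤+ (ℤₚ.0≤i-j⇒j≤i 0≤slack))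
      (from nonnegative (All.tabulate λ { {i , j} _ → ℤₚ.i≤j⇒0≤j-i (consistent i j) })))
    (λ horn i j → ℤₚ.0≤i-j⇒j≤i (All.lookup
      (to nonnegative (All.map (λ x≤y → ℤₚ.i≤j⇒0≤j-i (ℤ.+≤+ x≤y)) horn)) (∈-boundPairs i j)))
    where
    nonnegative : All (λ xy → 0ℤ ≤ slack xy) (hornInequalities lam μ ν) ⇔
                  All (λ ij → 0ℤ ≤ boundDifference ij) boundPairs
    nonnegative = All-map-≡ slack boundDifference (slacks≡ size) (0ℤ ≤_)

  tight⇔horn : SameSize → Tight ⇔ Any (uncurry _≡_) (hornInequalities lam μ ν)
  tight⇔horn size = mk⇔
    (λ (i , j , lower≡upper) → Any.map slack≡0⇒≡
      (from vanishing (lose (∈-boundPairs i j) (ℤₚ.i≡j⇒i-j≡0 (sym lower≡upper)))))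
    (λ horn →
      let (i , j) , difference≡0 = Any.satisfied (to vanishing (Any.map ≡⇒slack≡0 horn))
      in i , j , sym (ℤₚ.i-j≡0⇒i≡j (upper j) (lower i) difference≡0))
    where
    slack≡0⇒≡ : ∀ {xy} → slack xy ≡ 0ℤ → uncurry _≡_ xy
    slack≡0⇒≡ {x , y} slack≡0 = sym (ℤₚ.+-injective (ℤₚ.i-j≡0⇒i≡j (+ y) (+ x) slack≡0))
    ≡⇒slack≡0 : ∀ {xy} → uncurry _≡_ xy → slack xy ≡ 0ℤ
    ≡⇒slack≡0 x≡y = ℤₚ.i≡j⇒i-j≡0 (cong +_ (sym x≡y))
    vanishing : Any (λ xy → slack xy ≡ 0ℤ) (hornInequalities lam μ ν) ⇔
                Any (λ ij → boundDifference ij ≡ 0ℤ) boundPairs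
    vanishing = Any-map-≡ slack boundDifference (slacks≡ size) (_≡ 0ℤ)

  onFacet⇔ : (SameSize × Consistent × Tight) ⇔ OnFacet lam μ ν
  onFacet⇔ = mk⇔
    (λ (size , consistent , tight) →
      (ℤₚ.+-injective size , to (consistent⇔horn size) consistent) , to (tight⇔horn size) tight)
    (λ ((size , horn) , tight) →
        cong +_ size
      , from (consistent⇔horn (cong +_ size)) horn
      , from (tight⇔horn (cong +_ size)) tight)

open import Data.Nat using (_≤_)

theorem3p1 : (lam μ ν : Partition) → ℓ lam ≤ 3 → ℓ μ ≤ 3 → ℓ ν ≤ 3 →
    (c : ℤ) → IsLRCoefficient lam μ ν c →
    (c ≡ + 1) ⇔ OnFacet lam μ ν
theorem3p1 lam μ ν lam≤3 μ≤3 ν≤3 c isLR =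
  c ≡ + 1                                   ∼⟨ mk⇔ (λ c≡1 → ℤₚ.+-injective (trans (sym c≡length) c≡1))
                                                   (λ length≡1 → trans c≡length (cong +_ length≡1)) ⟩
  length (lrPatterns lam μ ν) ≡ 1           ∼⟨ ∃!⇔length≡1 (lrPatterns-unique lam μ ν) ⟩
  ∃! _≡_ (_∈ lrPatterns lam μ ν)            ∼⟨ ∃!-cong (∈-lrPatterns lam μ ν) ⟩
  ∃! _≡_ (λ t → Lattice t × HasWeight t)    ∼⟨ ∃!-hive⇔∃!-between ⟩
  (SameSize × ∃! _≡_ Between)               ∼⟨ ⇔-id SameSize ×-⇔ ∃!-between ⟩
  (SameSize × Consistent × Tight)           ∼⟨ onFacet⇔ lam μ ν ⟩
  OnFacet lam μ ν                           □
  where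
  open EquationalReasoning using (step-∼) renaming (_∎ to _□)
  open PartitionHive lam μ ν
  c≡length : c ≡ + length (lrPatterns lam μ ν)
  c≡length = littlewood-richardson lam μ ν lam≤3 μ≤3 ν≤3 isLR
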